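{- No randomized online algorithm for the Online Multi-Commodity Facility Location Problem with commodity set $S$ and $n$ requests can achieve a competitive ratio better than $\Omega\left(\sqrt{|S|}+\frac{\log n}{\log\log n}\right)$, even on line metrics. That is, there is an absolute constant $\kappa>0$ such that for every finite commodity set $S$ and every randomized online algorithm that is $c(|S|,n)$-competitive on instances with commodity set $S$ whose metric space is a finite subset of the real line, one has $c(|S|,n)\ge \kappa\left(\sqrt{|S|}+\frac{\log n}{\log\log n}\right)$ for all sufficiently large $n$.
   Context: Online Multi-Commodity Facility Location Problem (OMFLP). An instance consists of a finite metric space with point set $M$ and distance $d$, a finite nonempty set $S$ of commodities, construction costs $f_m^\sigma\ge 0$ for all $m\in M$ and $\sigma\subseteq S$ (all known in advance), and a sequence of $n$ requests. Each request $r$ is located at a point of $M$ and demands a nonempty set $s_r\subseteq S$; $d(m,r)$ denotes the distance from $m\in M$ to the location of $r$. A solution opens facilities, each at a point $m\in M$ with a configuration $\sigma\subseteq S$ (the set of commodities it offers), at cost $f_m^\sigma$; several facilities may be opened at the same point. Each request $r$ is assigned to a set of open facilities that jointly offer all commodities of $s_r$, at assignment cost equal to the sum of the distances from $r$ to these facilities. The total cost is the sum of all construction and assignment costs. Requests are revealed one by one; on arrival a request must immediately be assigned, where the algorithm may first open new facilities; all decisions are irrevocable. Standing assumptions on the costs: subadditivity, $f_m^{a\cup b}\le f_m^a+f_m^b$ for all $m\in M$, $a,b\subseteq S$; and $f_m^\sigma/|\sigma|\ge f_m^S/|S|$ for all $m\in M$ and nonempty $\sigma\subseteq S$. Competitive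 ratio: a (randomized) online algorithm is $c(|S|,n)$-competitive if there is a constant $a$, independent of the instance, such that on every instance its (expected) cost is at most $c(|S|,n)\cdot \mathrm{OPT}+a$, where OPT is the optimal offline cost of the instance and $n$ its number of requests. -}

module Defs where

open import Data.Bool.Base using (if_then_else_)
open import Data.Fin.Base using (Fin)
open import Data.Fin.Subset as Subset using (Subset; _∈_; _∪_; ⊤; Nonempty)
open import Data.Integer.Base as ℤ using (ℤ)
import Data.Integer.Properties as ℤ
open import Data.List.Base as List using (List; []; _∷_; _++_; length)
open import Data.Nat.Base as ℕ using (ℕ; zero; suc; z≤n; s≤s)
import Data.Nat.DivMod as ℕ
open import Data.Nat.Induction using (<-rec)
open import Data.Nat.Logarithm using (⌊log₂_⌋; ⌊log₂⌋-mono-≤; ⌊log₂[2^n]⌋≡n; ⌊log₂⌊n/2⌋⌋≡⌊log₂n⌋∸1)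
import Data.Nat.Properties as ℕ
import Data.Nat.Solver as ℕ
open import Data.Product.Base using (Σ-syntax; ∃-syntax; _×_; _,_; proj₁; proj₂)
open import Data.Rational.Base as ℚ using (ℚ; 0ℚ; 1ℚ; ½)
import Data.Rational.Properties as ℚ
open import Data.Rational.Solver using (module +-*-Solver)
open import Data.Sum.Base using (inj₁; inj₂)
import Data.Vec.Base as Vec
import Data.Vec.Functional as Vector
open import Function.Metric.Structures using (IsGeneralMetric)
open import Relation.Binary.PropositionalEquality using (_≡_; refl; sym; trans; cong; cong₂; subst; subst₂; module ≡-Reasoning)
open import Relation.Binary.Structures using (IsEquivalence; IsPartialOrder)
open import Relation.Nullary using (yes; no)

Cauchy : (ℕ → ℚ) → Set
Cauchy x = ∀ ε → 0ℚ ℚ.< ε → ∃[ N ] ∀ i j → N ℕ.≤ i → N ℕ.≤ j → ℚ.∣ x i ℚ.- x j ∣ ℚ.≤ ε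

record ℝ : Set where
  constructor real
  field
    seq    : ℕ → ℚ
    cauchy : Cauchy seq

open ℝ public

infix 4 _≤_ _<_ _≈_

_≤_ : ℝ → ℝ → Set
x ≤ y = ∀ ε → 0ℚ ℚ.< ε → ∃[ N ] ∀ n → N ℕ.≤ n → seq x n ℚ.≤ seq y n ℚ.+ ε

_<_ : ℝ → ℝ → Set
x < y = ∃[ ε ] 0ℚ ℚ.< ε × ∃[ N ] ∀ n → N ℕ.≤ n → seq x n ℚ.+ ε ℚ.≤ seq y n

_≈_ : ℝ → ℝ → Set
x ≈ y = x ≤ y × y ≤ x

module ℚ-Lemmas where

  ½-pos : ∀ {ε} → 0ℚ ℚ.< ε → 0ℚ ℚ.< ½ ℚ.* ε
  ½-pos {ε} 0<ε = subst (ℚ._< ½ ℚ.* ε) (ℚ.*-zeroʳ ½) (ℚ.*-monoʳ-<-pos ½ 0<ε)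

  ½+½ : ∀ ε → ½ ℚ.* ε ℚ.+ ½ ℚ.* ε ≡ ε
  ½+½ ε = trans (sym (ℚ.*-distribʳ-+ ε ½ ½)) (ℚ.*-identityˡ ε)

  p≤∣p∣ : ∀ p → p ℚ.≤ ℚ.∣ p ∣
  p≤∣p∣ p with ℚ.≤-total 0ℚ p
  ... | inj₁ 0≤p = ℚ.≤-reflexive (sym (ℚ.0≤p⇒∣p∣≡p 0≤p))
  ... | inj₂ p≤0 = ℚ.≤-trans p≤0 (ℚ.0≤∣p∣ p)

  ∣-∣-bound : ∀ {p b} → p ℚ.≤ b → ℚ.- p ℚ.≤ b → ℚ.∣ p ∣ ℚ.≤ b
  ∣-∣-bound {p} p≤b -p≤b with ℚ.∣p∣≡p∨∣p∣≡-p p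
  ... | inj₁ e = ℚ.≤-trans (ℚ.≤-reflexive e) p≤b
  ... | inj₂ e = ℚ.≤-trans (ℚ.≤-reflexive e) -p≤b

  p-q≤r : ∀ {p q r} → p ℚ.≤ q ℚ.+ r → p ℚ.- q ℚ.≤ r
  p-q≤r {p} {q} {r} h = ℚ.≤-trans (ℚ.+-monoˡ-≤ (ℚ.- q) h) (ℚ.≤-reflexive
    (solve 2 (λ q r → q :+ r :- q := r) refl q r))
    where open +-*-Solver

  p≤q+r : ∀ {p q r} → p ℚ.- q ℚ.≤ r → p ℚ.≤ q ℚ.+ r
  p≤q+r {p} {q} {r} h = ℚ.≤-trans (ℚ.≤-reflexive
    (solve 2 (λ p q → p := q :+ (p :- q)) refl p q)) (ℚ.+-monoʳ-≤ q h)
    where open +-*-Solver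

  -[p-q] : ∀ p q → ℚ.- (p ℚ.- q) ≡ q ℚ.- p
  -[p-q] = solve 2 (λ p q → :- (p :- q) := q :- p) refl
    where open +-*-Solver

  dist-bound : ∀ {p q b} → p ℚ.≤ q ℚ.+ b → q ℚ.≤ p ℚ.+ b → ℚ.∣ p ℚ.- q ∣ ℚ.≤ b
  dist-bound {p} {q} h k =
    ∣-∣-bound (p-q≤r h) (ℚ.≤-trans (ℚ.≤-reflexive (-[p-q] p q)) (p-q≤r k))

  dist-elim : ∀ {p q b} → ℚ.∣ p ℚ.- q ∣ ℚ.≤ b → p ℚ.≤ q ℚ.+ b
  dist-elim {p} {q} h = p≤q+r (ℚ.≤-trans (p≤∣p∣ (p ℚ.- q)) h)

  dist-sym : ∀ p q → ℚ.∣ p ℚ.- q ∣ ≡ ℚ.∣ q ℚ.- p ∣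
  dist-sym p q = trans (sym (ℚ.∣-p∣≡∣p∣ (p ℚ.- q))) (cong ℚ.∣_∣ (-[p-q] p q))

  ∣∣-lipschitz : ∀ p q → ℚ.∣ ℚ.∣ p ∣ ℚ.- ℚ.∣ q ∣ ∣ ℚ.≤ ℚ.∣ p ℚ.- q ∣
  ∣∣-lipschitz p q = dist-bound (half p q)
    (ℚ.≤-trans (half q p) (ℚ.≤-reflexive (cong (ℚ.∣ p ∣ ℚ.+_) (dist-sym q p))))
    where
    open +-*-Solver
    half : ∀ p q → ℚ.∣ p ∣ ℚ.≤ ℚ.∣ q ∣ ℚ.+ ℚ.∣ p ℚ.- q ∣
    half p q = ℚ.≤-trans (ℚ.≤-reflexive (cong ℚ.∣_∣
      (solve 2 (λ p q → p := q :+ (p :- q)) refl p q))) (ℚ.∣p+q∣≤∣p∣+∣q∣ q (p ℚ.- q))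

  *-mono-≤ : ∀ {p q r s} → 0ℚ ℚ.≤ r → 0ℚ ℚ.≤ q → p ℚ.≤ q → r ℚ.≤ s → p ℚ.* r ℚ.≤ q ℚ.* s
  *-mono-≤ {p} {q} {r} {s} 0≤r 0≤q p≤q r≤s = ℚ.≤-trans
    (ℚ.*-monoʳ-≤-nonNeg r {{ℚ.nonNegative 0≤r}} p≤q)
    (ℚ.*-monoˡ-≤-nonNeg q {{ℚ.nonNegative 0≤q}} r≤s)

  *-pos : ∀ {p q} → 0ℚ ℚ.< p → 0ℚ ℚ.< q → 0ℚ ℚ.< p ℚ.* q
  *-pos {p} {q} 0<p 0<q = ℚ.positive⁻¹ (p ℚ.* q)
    {{ℚ.pos*pos⇒pos p {{ℚ.positive 0<p}} q {{ℚ.positive 0<q}}}}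

  1/_⟨_⟩ : ∀ p → 0ℚ ℚ.< p → ℚ
  1/ p ⟨ 0<p ⟩ = (ℚ.1/ p) {{ℚ.>-nonZero 0<p}}

  1/-pos : ∀ p (0<p : 0ℚ ℚ.< p) → 0ℚ ℚ.< 1/ p ⟨ 0<p ⟩
  1/-pos p 0<p = ℚ.positive⁻¹ _ {{ℚ.1/pos⇒pos p {{ℚ.positive 0<p}}}}

  1/-inv : ∀ p (0<p : 0ℚ ℚ.< p) → 1/ p ⟨ 0<p ⟩ ℚ.* p ≡ 1ℚ
  1/-inv p 0<p = ℚ.*-inverseˡ p {{ℚ.>-nonZero 0<p}}

  1/-anti : ∀ {p q} (0<p : 0ℚ ℚ.< p) (0<q : 0ℚ ℚ.< q) → p ℚ.≤ q → 1/ q ⟨ 0<q ⟩ ℚ.≤ 1/ p ⟨ 0<p ⟩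
  1/-anti {p} {q} 0<p 0<q p≤q = begin
    q⁻¹               ≡⟨ sym (ℚ.*-identityʳ q⁻¹) ⟩
    q⁻¹ ℚ.* 1ℚ        ≡⟨ cong (q⁻¹ ℚ.*_) (sym (1/-inv p 0<p)) ⟩
    q⁻¹ ℚ.* (p⁻¹ ℚ.* p) ≤⟨ ℚ.*-monoˡ-≤-nonNeg q⁻¹ {{nn q⁻¹ (1/-pos q 0<q)}}
                           (ℚ.*-monoˡ-≤-nonNeg p⁻¹ {{nn p⁻¹ (1/-pos p 0<p)}} p≤q) ⟩
    q⁻¹ ℚ.* (p⁻¹ ℚ.* q) ≡⟨ solve 3 (λ a b c → a :* (b :* c) := b :* (a :* c)) refl q⁻¹ p⁻¹ q ⟩
    p⁻¹ ℚ.* (q⁻¹ ℚ.* q) ≡⟨ cong (p⁻¹ ℚ.*_) (1/-inv q 0<q) ⟩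
    p⁻¹ ℚ.* 1ℚ        ≡⟨ ℚ.*-identityʳ p⁻¹ ⟩
    p⁻¹               ∎
    where
    open ℚ.≤-Reasoning
    open +-*-Solver
    q⁻¹ = 1/ q ⟨ 0<q ⟩
    p⁻¹ = 1/ p ⟨ 0<p ⟩
    nn : ∀ r → 0ℚ ℚ.< r → ℚ.NonNegative r
    nn r h = ℚ.nonNegative (ℚ.<⇒≤ h)

  -- 1/p - 1/q = (q - p) / (p q)
  1/-diff : ∀ {p q} (0<p : 0ℚ ℚ.< p) (0<q : 0ℚ ℚ.< q) →
            1/ p ⟨ 0<p ⟩ ℚ.- 1/ q ⟨ 0<q ⟩ ≡ (q ℚ.- p) ℚ.* (1/ p ⟨ 0<p ⟩ ℚ.* 1/ q ⟨ 0<q ⟩)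
  1/-diff {p} {q} 0<p 0<q = begin
    p⁻¹ ℚ.- q⁻¹ ≡⟨ cong₂ ℚ._-_ (sym (ℚ.*-identityʳ p⁻¹)) (sym (ℚ.*-identityʳ q⁻¹)) ⟩
    p⁻¹ ℚ.* 1ℚ ℚ.- q⁻¹ ℚ.* 1ℚ
      ≡⟨ cong₂ (λ u v → p⁻¹ ℚ.* u ℚ.- q⁻¹ ℚ.* v) (sym (1/-inv q 0<q)) (sym (1/-inv p 0<p)) ⟩
    p⁻¹ ℚ.* (q⁻¹ ℚ.* q) ℚ.- q⁻¹ ℚ.* (p⁻¹ ℚ.* p)
      ≡⟨ solve 4 (λ a b p q → a :* (b :* q) :- b :* (a :* p) := (q :- p) :* (a :* b)) refl p⁻¹ q⁻¹ p q ⟩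
    (q ℚ.- p) ℚ.* (p⁻¹ ℚ.* q⁻¹) ∎
    where
    open ≡-Reasoning
    open +-*-Solver
    q⁻¹ = 1/ q ⟨ 0<q ⟩
    p⁻¹ = 1/ p ⟨ 0<p ⟩

open ℚ-Lemmas

≤-refl : ∀ {x} → x ≤ x
≤-refl {x} ε 0<ε = 0 , λ n _ → ℚ.≤-trans (ℚ.≤-reflexive (sym (ℚ.+-identityʳ (seq x n))))
  (ℚ.+-monoʳ-≤ (seq x n) (ℚ.<⇒≤ 0<ε))

≤-trans : ∀ {x y z} → x ≤ y → y ≤ z → x ≤ z
≤-trans {x} {y} {z} p q ε 0<ε with p (½ ℚ.* ε) (½-pos 0<ε) | q (½ ℚ.* ε) (½-pos 0<ε)
... | M , f | N , g = M ℕ.⊔ N , λ n h → begin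
  seq x n                               ≤⟨ f n (ℕ.≤-trans (ℕ.m≤m⊔n M N) h) ⟩
  seq y n ℚ.+ ½ ℚ.* ε                   ≤⟨ ℚ.+-monoˡ-≤ (½ ℚ.* ε) (g n (ℕ.≤-trans (ℕ.m≤n⊔m M N) h)) ⟩
  seq z n ℚ.+ ½ ℚ.* ε ℚ.+ ½ ℚ.* ε       ≡⟨ ℚ.+-assoc (seq z n) _ _ ⟩
  seq z n ℚ.+ (½ ℚ.* ε ℚ.+ ½ ℚ.* ε)     ≡⟨ cong (seq z n ℚ.+_) (½+½ ε) ⟩
  seq z n ℚ.+ ε                         ∎
  where open ℚ.≤-Reasoning

≈-isEquivalence : IsEquivalence _≈_
≈-isEquivalence = record
  { refl  = λ {x} → ≤-refl {x} , ≤-refl {x}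
  ; sym   = λ (p , q) → q , p
  ; trans = λ {x} {y} {z} (p , p′) (q , q′) → ≤-trans {x} {y} {z} p q , ≤-trans {z} {y} {x} q′ p′
  }

≤-isPartialOrder : IsPartialOrder _≈_ _≤_
≤-isPartialOrder = record
  { isPreorder = record
    { isEquivalence = ≈-isEquivalence
    ; reflexive     = proj₁
    ; trans         = λ {x} {y} {z} → ≤-trans {x} {y} {z}
    }
  ; antisym = _,_
  }

opaque
  fromℚ : ℚ → ℝ
  fromℚ q = real (λ _ → q) λ ε 0<ε → 0 , λ _ _ _ _ →
    ℚ.≤-trans (ℚ.≤-reflexive (cong ℚ.∣_∣ (ℚ.+-inverseʳ q))) (ℚ.<⇒≤ 0<ε)

fromℕ : ℕ → ℝ
fromℕ n = fromℚ (ℤ.+ n ℚ./ 1)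

0ℝ : ℝ
0ℝ = fromℚ 0ℚ

opaque
  infixl 6 _+_

  _+_ : ℝ → ℝ → ℝ
  seq (x + y) n = seq x n ℚ.+ seq y n
  cauchy (x + y) ε 0<ε with cauchy x (½ ℚ.* ε) (½-pos 0<ε) | cauchy y (½ ℚ.* ε) (½-pos 0<ε)
  ... | M , f | N , g = M ℕ.⊔ N , λ i j h k → begin
    ℚ.∣ seq x i ℚ.+ seq y i ℚ.- (seq x j ℚ.+ seq y j) ∣
      ≡⟨ cong ℚ.∣_∣ (solve 4 (λ a b c d → a :+ b :- (c :+ d) := (a :- c) :+ (b :- d)) refl
          (seq x i) (seq y i) (seq x j) (seq y j)) ⟩
    ℚ.∣ (seq x i ℚ.- seq x j) ℚ.+ (seq y i ℚ.- seq y j) ∣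
      ≤⟨ ℚ.∣p+q∣≤∣p∣+∣q∣ (seq x i ℚ.- seq x j) (seq y i ℚ.- seq y j) ⟩
    ℚ.∣ seq x i ℚ.- seq x j ∣ ℚ.+ ℚ.∣ seq y i ℚ.- seq y j ∣
      ≤⟨ ℚ.+-mono-≤ (f i j (ℕ.≤-trans (ℕ.m≤m⊔n M N) h) (ℕ.≤-trans (ℕ.m≤m⊔n M N) k))
                    (g i j (ℕ.≤-trans (ℕ.m≤n⊔m M N) h) (ℕ.≤-trans (ℕ.m≤n⊔m M N) k)) ⟩
    ½ ℚ.* ε ℚ.+ ½ ℚ.* ε ≡⟨ ½+½ ε ⟩
    ε ∎
    where
    open ℚ.≤-Reasoning
    open +-*-Solver

opaque
  infix 8 -_

  -_ : ℝ → ℝ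
  seq (- x) n = ℚ.- seq x n
  cauchy (- x) ε 0<ε with cauchy x ε 0<ε
  ... | N , f = N , λ i j h k → ℚ.≤-trans (ℚ.≤-reflexive (trans
    (cong ℚ.∣_∣ (solve 2 (λ a b → :- a :- (:- b) := b :- a) refl (seq x i) (seq x j)))
    (dist-sym (seq x j) (seq x i)))) (f i j h k)
    where open +-*-Solver

infixl 6 _-_

_-_ : ℝ → ℝ → ℝ
x - y = x + (- y)

opaque
  ∣_∣ : ℝ → ℝ
  seq ∣ x ∣ n = ℚ.∣ seq x n ∣
  cauchy ∣ x ∣ ε 0<ε with cauchy x ε 0<ε
  ... | N , f = N , λ i j h k → ℚ.≤-trans (∣∣-lipschitz (seq x i) (seq x j)) (f i j h k)

eventually-bounded : ∀ x → ∃[ B ] 0ℚ ℚ.< B × ∃[ N ] ∀ n → N ℕ.≤ n → ℚ.∣ seq x n ∣ ℚ.≤ B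
eventually-bounded x with cauchy x 1ℚ (ℚ.positive⁻¹ 1ℚ)
... | N , f = B , 0<B , N , λ n h → begin
  ℚ.∣ seq x n ∣
    ≡⟨ cong ℚ.∣_∣ (solve 2 (λ p q → p := q :+ (p :- q)) refl (seq x n) (seq x N)) ⟩
  ℚ.∣ seq x N ℚ.+ (seq x n ℚ.- seq x N) ∣
    ≤⟨ ℚ.∣p+q∣≤∣p∣+∣q∣ (seq x N) (seq x n ℚ.- seq x N) ⟩
  ℚ.∣ seq x N ∣ ℚ.+ ℚ.∣ seq x n ℚ.- seq x N ∣
    ≤⟨ ℚ.+-monoʳ-≤ ℚ.∣ seq x N ∣ (f n N h ℕ.≤-refl) ⟩
  B ∎
  where
  open ℚ.≤-Reasoning
  open +-*-Solver
  B = ℚ.∣ seq x N ∣ ℚ.+ 1ℚ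
  0<B : 0ℚ ℚ.< B
  0<B = ℚ.+-mono-≤-< (ℚ.0≤∣p∣ (seq x N)) (ℚ.positive⁻¹ 1ℚ)

small-product : ∀ {b} ε (0<b : 0ℚ ℚ.< b) p q → ℚ.∣ p ∣ ℚ.≤ b →
                ℚ.∣ q ∣ ℚ.≤ ε ℚ.* 1/ b ⟨ 0<b ⟩ → ℚ.∣ p ℚ.* q ∣ ℚ.≤ ε
small-product {b} ε 0<b p q hp hq = begin
  ℚ.∣ p ℚ.* q ∣             ≡⟨ ℚ.∣p*q∣≡∣p∣*∣q∣ p q ⟩
  ℚ.∣ p ∣ ℚ.* ℚ.∣ q ∣       ≤⟨ *-mono-≤ (ℚ.0≤∣p∣ q) (ℚ.<⇒≤ 0<b) hp hq ⟩
  b ℚ.* (ε ℚ.* c)           ≡⟨ solve 3 (λ b e c → b :* (e :* c) := e :* (c :* b)) refl b ε c ⟩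
  ε ℚ.* (c ℚ.* b)           ≡⟨ cong (ε ℚ.*_) (1/-inv b 0<b) ⟩
  ε ℚ.* 1ℚ                  ≡⟨ ℚ.*-identityʳ ε ⟩
  ε                         ∎
  where
  open ℚ.≤-Reasoning
  open +-*-Solver
  c = 1/ b ⟨ 0<b ⟩

product-dist : ∀ {e} p q r s → ℚ.∣ p ℚ.* (q ℚ.- s) ∣ ℚ.≤ e → ℚ.∣ s ℚ.* (p ℚ.- r) ∣ ℚ.≤ e →
               ℚ.∣ p ℚ.* q ℚ.- r ℚ.* s ∣ ℚ.≤ e ℚ.+ e
product-dist {e} p q r s h k = begin
  ℚ.∣ p ℚ.* q ℚ.- r ℚ.* s ∣
    ≡⟨ cong ℚ.∣_∣ (solve 4 (λ p q r s → p :* q :- r :* s := p :* (q :- s) :+ s :* (p :- r)) refl p q r s) ⟩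
  ℚ.∣ p ℚ.* (q ℚ.- s) ℚ.+ s ℚ.* (p ℚ.- r) ∣
    ≤⟨ ℚ.∣p+q∣≤∣p∣+∣q∣ (p ℚ.* (q ℚ.- s)) (s ℚ.* (p ℚ.- r)) ⟩
  ℚ.∣ p ℚ.* (q ℚ.- s) ∣ ℚ.+ ℚ.∣ s ℚ.* (p ℚ.- r) ∣
    ≤⟨ ℚ.+-mono-≤ h k ⟩
  e ℚ.+ e ∎
  where
  open ℚ.≤-Reasoning
  open +-*-Solver

*-cauchy : ∀ x y → Cauchy (λ n → seq x n ℚ.* seq y n)
*-cauchy x y ε 0<ε = M ℕ.⊔ N , λ i j h k →
  ℚ.≤-trans (product-dist {½ ℚ.* ε} (seq x i) (seq y i) (seq x j) (seq y j)
    (small-product (½ ℚ.* ε) 0<B (seq x i) (seq y i ℚ.- seq y j) (x≤B i (m₁ h)) (y-close i j (n₂ h) (n₂ k)))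
    (small-product (½ ℚ.* ε) 0<C (seq y j) (seq x i ℚ.- seq x j) (y≤C j (m₂ k)) (x-close i j (n₁ h) (n₁ k))))
  (ℚ.≤-reflexive (½+½ ε))
  where
  x-bounded = eventually-bounded x
  y-bounded = eventually-bounded y
  B = proj₁ x-bounded
  C = proj₁ y-bounded
  0<B = proj₁ (proj₂ x-bounded)
  0<C = proj₁ (proj₂ y-bounded)
  M₁ = proj₁ (proj₂ (proj₂ x-bounded))
  M₂ = proj₁ (proj₂ (proj₂ y-bounded))
  x≤B = proj₂ (proj₂ (proj₂ x-bounded))
  y≤C = proj₂ (proj₂ (proj₂ y-bounded))
  x-cauchy = cauchy x (½ ℚ.* ε ℚ.* 1/ C ⟨ 0<C ⟩) (*-pos (½-pos 0<ε) (1/-pos C 0<C))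
  y-cauchy = cauchy y (½ ℚ.* ε ℚ.* 1/ B ⟨ 0<B ⟩) (*-pos (½-pos 0<ε) (1/-pos B 0<B))
  N₁ = proj₁ x-cauchy
  N₂ = proj₁ y-cauchy
  x-close = proj₂ x-cauchy
  y-close = proj₂ y-cauchy
  M = M₁ ℕ.⊔ M₂
  N = N₁ ℕ.⊔ N₂
  m₁ : ∀ {i} → M ℕ.⊔ N ℕ.≤ i → M₁ ℕ.≤ i
  m₁ h = ℕ.m⊔n≤o⇒m≤o M₁ M₂ (ℕ.m⊔n≤o⇒m≤o M N h)
  m₂ : ∀ {i} → M ℕ.⊔ N ℕ.≤ i → M₂ ℕ.≤ i
  m₂ h = ℕ.m⊔n≤o⇒n≤o M₁ M₂ (ℕ.m⊔n≤o⇒m≤o M N h)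
  n₁ : ∀ {i} → M ℕ.⊔ N ℕ.≤ i → N₁ ℕ.≤ i
  n₁ h = ℕ.m⊔n≤o⇒m≤o N₁ N₂ (ℕ.m⊔n≤o⇒n≤o M N h)
  n₂ : ∀ {i} → M ℕ.⊔ N ℕ.≤ i → N₂ ℕ.≤ i
  n₂ h = ℕ.m⊔n≤o⇒n≤o N₁ N₂ (ℕ.m⊔n≤o⇒n≤o M N h)

opaque
  infixl 7 _*_

  _*_ : ℝ → ℝ → ℝ
  x * y = real (λ n → seq x n ℚ.* seq y n) (*-cauchy x y)

infixl 7 _÷_[_] _/ℕ_

_/ℕ_ : ℝ → (n : ℕ) → .{{_ : ℕ.NonZero n}} → ℝ
x /ℕ n = x * fromℚ (ℤ.+ 1 ℚ./ n)

-- The witness δ of 0 < x is a lower bound for x, so replacing every term t of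
-- the sequence by t ⊔ δ changes only finitely many of them.
opaque
  unfolding fromℚ

  recip : ∀ x → 0ℝ < x → ℝ
  recip x (δ , 0<δ , N , δ≤x) = real inv inv-cauchy
    where
    pos : ∀ n → 0ℚ ℚ.< seq x n ℚ.⊔ δ
    pos n = ℚ.<-≤-trans 0<δ (ℚ.p≤q⊔p (seq x n) δ)
    inv : ℕ → ℚ
    inv n = 1/ seq x n ℚ.⊔ δ ⟨ pos n ⟩
    δ⁻¹ : ℚ
    δ⁻¹ = 1/ δ ⟨ 0<δ ⟩
    collapse : ∀ n → N ℕ.≤ n → seq x n ℚ.⊔ δ ≡ seq x n
    collapse n h = ℚ.p≥q⇒p⊔q≡p (ℚ.≤-trans (ℚ.≤-reflexive (sym (ℚ.+-identityˡ δ))) (δ≤x n h))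
    inv-cauchy : Cauchy inv
    inv-cauchy ε 0<ε with cauchy x (ε ℚ.* (δ ℚ.* δ)) (*-pos 0<ε (*-pos 0<δ 0<δ))
    ... | M , f = M ℕ.⊔ N , λ i j h k → begin
      ℚ.∣ inv i ℚ.- inv j ∣
        ≡⟨ cong ℚ.∣_∣ (1/-diff (pos i) (pos j)) ⟩
      ℚ.∣ ((seq x j ℚ.⊔ δ) ℚ.- (seq x i ℚ.⊔ δ)) ℚ.* (inv i ℚ.* inv j) ∣
        ≡⟨ cong₂ (λ u v → ℚ.∣ (u ℚ.- v) ℚ.* (inv i ℚ.* inv j) ∣)
            (collapse j (ℕ.m⊔n≤o⇒n≤o M N k)) (collapse i (ℕ.m⊔n≤o⇒n≤o M N h)) ⟩
      ℚ.∣ (seq x j ℚ.- seq x i) ℚ.* (inv i ℚ.* inv j) ∣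
        ≡⟨ ℚ.∣p*q∣≡∣p∣*∣q∣ (seq x j ℚ.- seq x i) (inv i ℚ.* inv j) ⟩
      ℚ.∣ seq x j ℚ.- seq x i ∣ ℚ.* ℚ.∣ inv i ℚ.* inv j ∣
        ≡⟨ cong (ℚ.∣ seq x j ℚ.- seq x i ∣ ℚ.*_)
             (ℚ.0≤p⇒∣p∣≡p (ℚ.<⇒≤ (*-pos (1/-pos _ (pos i)) (1/-pos _ (pos j))))) ⟩
      ℚ.∣ seq x j ℚ.- seq x i ∣ ℚ.* (inv i ℚ.* inv j)
        ≤⟨ *-mono-≤ (ℚ.<⇒≤ (*-pos (1/-pos _ (pos i)) (1/-pos _ (pos j))))
             (ℚ.<⇒≤ (*-pos 0<ε (*-pos 0<δ 0<δ)))
             (f j i (ℕ.m⊔n≤o⇒m≤o M N k) (ℕ.m⊔n≤o⇒m≤o M N h))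
             (*-mono-≤ (ℚ.<⇒≤ (1/-pos _ (pos j))) (ℚ.<⇒≤ (1/-pos δ 0<δ)) (small i) (small j)) ⟩
      ε ℚ.* (δ ℚ.* δ) ℚ.* (δ⁻¹ ℚ.* δ⁻¹)
        ≡⟨ solve 3 (λ e d c → e :* (d :* d) :* (c :* c) := e :* ((c :* d) :* (c :* d))) refl ε δ δ⁻¹ ⟩
      ε ℚ.* ((δ⁻¹ ℚ.* δ) ℚ.* (δ⁻¹ ℚ.* δ))
        ≡⟨ cong (λ u → ε ℚ.* (u ℚ.* u)) (1/-inv δ 0<δ) ⟩
      ε ℚ.* 1ℚ
        ≡⟨ ℚ.*-identityʳ ε ⟩
      ε ∎
      where
      open ℚ.≤-Reasoning
      open +-*-Solver
      small : ∀ n → inv n ℚ.≤ δ⁻¹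
      small n = 1/-anti 0<δ (pos n) (ℚ.p≤q⊔p (seq x n) δ)

_÷_[_] : ℝ → (y : ℝ) → 0ℝ < y → ℝ
x ÷ y [ 0<y ] = x * recip y 0<y

infixl 7 _//_

_//_ : ℕ → (d : ℕ) → .{{_ : ℕ.NonZero d}} → ℚ
n // d = ℤ.+ n ℚ./ d

module Frac where
  open import Data.Rational.Unnormalised.Base as ℚᵘ using (ℚᵘ; mkℚᵘ; *≡*; *≤*)
  import Data.Rational.Unnormalised.Properties as ℚᵘ

  toℚᵘ-// : ∀ n d → ℚ.toℚᵘ (n // suc d) ℚᵘ.≃ mkℚᵘ (ℤ.+ n) d
  toℚᵘ-// n d = ℚ.toℚᵘ-fromℚᵘ (mkℚᵘ (ℤ.+ n) d)

  //-mono : ∀ {m n} c d → m ℕ.* suc d ℕ.≤ n ℕ.* suc c → (m // suc c) ℚ.≤ (n // suc d)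
  //-mono {m} {n} c d h = ℚ.toℚᵘ-cancel-≤ (ℚᵘ.≤-trans (ℚᵘ.≤-reflexive (toℚᵘ-// m c))
    (ℚᵘ.≤-trans (*≤* (subst₂ ℤ._≤_ (ℤ.pos-* m (suc d)) (ℤ.pos-* n (suc c)) (ℤ.+≤+ h)))
      (ℚᵘ.≤-reflexive (ℚᵘ.≃-sym (toℚᵘ-// n d)))))

  //-mono⁻¹ : ∀ {m n} c d → (m // suc c) ℚ.≤ (n // suc d) → m ℕ.* suc d ℕ.≤ n ℕ.* suc c
  //-mono⁻¹ {m} {n} c d h = ℤ.drop‿+≤+ (subst₂ ℤ._≤_ (sym (ℤ.pos-* m (suc d))) (sym (ℤ.pos-* n (suc c)))
    (ℚᵘ.drop-*≤* (ℚᵘ.≤-trans (ℚᵘ.≤-reflexive (ℚᵘ.≃-sym (toℚᵘ-// m c)))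
      (ℚᵘ.≤-trans (ℚ.toℚᵘ-mono-≤ h) (ℚᵘ.≤-reflexive (toℚᵘ-// n d))))))

  //-+ : ∀ m n c d → (m // suc c) ℚ.+ (n // suc d) ≡ (m ℕ.* suc d ℕ.+ n ℕ.* suc c) // (suc c ℕ.* suc d)
  //-+ m n c d = ℚ.toℚᵘ-injective (ℚᵘ.≃-trans (ℚ.toℚᵘ-homo-+ (m // suc c) (n // suc d))
    (ℚᵘ.≃-trans (ℚᵘ.+-cong (toℚᵘ-// m c) (toℚᵘ-// n d))
      (ℚᵘ.≃-trans (ℚᵘ.≃-reflexive (cong (λ z → mkℚᵘ z (d ℕ.+ c ℕ.* suc d))
         (cong₂ ℤ._+_ (sym (ℤ.pos-* m (suc d))) (sym (ℤ.pos-* n (suc c))))))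
        (ℚᵘ.≃-sym (toℚᵘ-// (m ℕ.* suc d ℕ.+ n ℕ.* suc c) (d ℕ.+ c ℕ.* suc d))))))

  //-* : ∀ m n c d → (m // suc c) ℚ.* (n // suc d) ≡ (m ℕ.* n) // (suc c ℕ.* suc d)
  //-* m n c d = ℚ.toℚᵘ-injective (ℚᵘ.≃-trans (ℚ.toℚᵘ-homo-* (m // suc c) (n // suc d))
    (ℚᵘ.≃-trans (ℚᵘ.*-cong (toℚᵘ-// m c) (toℚᵘ-// n d))
      (ℚᵘ.≃-trans (ℚᵘ.≃-reflexive (cong (λ z → mkℚᵘ z (d ℕ.+ c ℕ.* suc d)) (sym (ℤ.pos-* m n))))
        (ℚᵘ.≃-sym (toℚᵘ-// (m ℕ.* n) (d ℕ.+ c ℕ.* suc d))))))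

  archimedean : ∀ ε → 0ℚ ℚ.< ε → ∃[ m ] (1 // suc m) ℚ.≤ ε
  archimedean ε@(ℚ.mkℚ (ℤ.+ zero) d c) 0<ε with () ← ℚ.positive 0<ε
  archimedean ε@(ℚ.mkℚ (ℤ.+ (suc n)) d c) 0<ε = d , ℚ.≤-trans (//-mono {1} {suc n} d d
    (ℕ.*-monoˡ-≤ (suc d) {1} {suc n} (s≤s z≤n))) (ℚ.≤-reflexive (ℚ.↥p/↧p≡p ε))
  archimedean ε@(ℚ.mkℚ (ℤ.-[1+ n ]) d c) 0<ε with () ← ℚ.positive 0<ε

open Frac

-- The hypothesis says aᵢ/i ≤ (1 + aⱼ)/j + 1/m, cleared of denominators.
grid-cauchy : (a : ℕ → ℕ) →
  (∀ m → ∃[ N ] ∀ i j → N ℕ.≤ i → N ℕ.≤ j →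
    a i ℕ.* (suc j ℕ.* suc m) ℕ.≤ suc (a j) ℕ.* (suc i ℕ.* suc m) ℕ.+ suc i ℕ.* suc j) →
  Cauchy (λ k → a k // suc k)
grid-cauchy a close ε 0<ε
  with m , 1/m≤ε/2 ← archimedean (½ ℚ.* ε) (½-pos 0<ε)
  with N , f ← close m
  = N ℕ.⊔ m , λ i j h k → dist-bound
      (half i j (ℕ.m⊔n≤o⇒m≤o N m h) (ℕ.m⊔n≤o⇒m≤o N m k) (ℕ.m⊔n≤o⇒n≤o N m k))
      (half j i (ℕ.m⊔n≤o⇒m≤o N m k) (ℕ.m⊔n≤o⇒m≤o N m h) (ℕ.m⊔n≤o⇒n≤o N m h))
  where
  open ℚ.≤-Reasoning
  open ℕ.+-*-Solver
  half : ∀ i j → N ℕ.≤ i → N ℕ.≤ j → m ℕ.≤ j → (a i // suc i) ℚ.≤ (a j // suc j) ℚ.+ ε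
  half i j h k m≤j = begin
    a i // suc i
      ≤⟨ //-mono {a i} {suc (a j) ℕ.* suc m ℕ.+ 1 ℕ.* suc j} i (m ℕ.+ j ℕ.* suc m)
           (ℕ.≤-trans (f i j h k) (ℕ.≤-reflexive
             (solve 4 (λ p i j m → p :* (i :* m) :+ i :* j := (p :* m :+ con 1 :* j) :* i) refl
               (suc (a j)) (suc i) (suc j) (suc m)))) ⟩
    (suc (a j) ℕ.* suc m ℕ.+ 1 ℕ.* suc j) // (suc j ℕ.* suc m)
      ≡⟨ //-+ (suc (a j)) 1 j m ⟨
    (suc (a j) // suc j) ℚ.+ (1 // suc m)
      ≤⟨ ℚ.+-mono-≤ split 1/m≤ε/2 ⟩
    (a j // suc j) ℚ.+ ½ ℚ.* ε ℚ.+ ½ ℚ.* ε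
      ≡⟨ ℚ.+-assoc (a j // suc j) _ _ ⟩
    (a j // suc j) ℚ.+ (½ ℚ.* ε ℚ.+ ½ ℚ.* ε)
      ≡⟨ cong ((a j // suc j) ℚ.+_) (½+½ ε) ⟩
    (a j // suc j) ℚ.+ ε ∎
    where
    split : (suc (a j) // suc j) ℚ.≤ (a j // suc j) ℚ.+ ½ ℚ.* ε
    split = begin
      suc (a j) // suc j
        ≤⟨ //-mono {suc (a j)} {a j ℕ.* suc j ℕ.+ 1 ℕ.* suc j} j (j ℕ.+ j ℕ.* suc j)
             (ℕ.≤-reflexive (solve 2 (λ p j → (con 1 :+ p) :* (j :* j) := (p :* j :+ con 1 :* j) :* j) refl
               (a j) (suc j))) ⟩
      (a j ℕ.* suc j ℕ.+ 1 ℕ.* suc j) // (suc j ℕ.* suc j)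
        ≡⟨ //-+ (a j) 1 j j ⟨
      (a j // suc j) ℚ.+ (1 // suc j)
        ≤⟨ ℚ.+-monoʳ-≤ (a j // suc j) (ℚ.≤-trans (//-mono {1} {1} j m (ℕ.*-monoʳ-≤ 1 (s≤s m≤j))) 1/m≤ε/2) ⟩
      (a j // suc j) ℚ.+ ½ ℚ.* ε ∎

isqrt : ℕ → ℕ
isqrt zero = zero
isqrt (suc n) with suc (isqrt n) ℕ.* suc (isqrt n) ℕ.≤? suc n
... | yes _ = suc (isqrt n)
... | no  _ = isqrt n

isqrt-lower : ∀ n → isqrt n ℕ.* isqrt n ℕ.≤ n
isqrt-lower zero = z≤n
isqrt-lower (suc n) with suc (isqrt n) ℕ.* suc (isqrt n) ℕ.≤? suc n
... | yes h = h
... | no  _ = ℕ.m≤n⇒m≤1+n (isqrt-lower n)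

isqrt-upper : ∀ n → n ℕ.< suc (isqrt n) ℕ.* suc (isqrt n)
isqrt-upper zero = s≤s z≤n
isqrt-upper (suc n) with suc (isqrt n) ℕ.* suc (isqrt n) ℕ.≤? suc n
... | no  h = ℕ.≰⇒> h
... | yes _ = ℕ.≤-trans (s≤s (isqrt-upper n))
  (ℕ.*-mono-< {suc (isqrt n)} {suc (suc (isqrt n))} {suc (isqrt n)} ℕ.≤-refl ℕ.≤-refl)

-- Approximants ⌊ √(s k²) ⌋ / k.
opaque
  √ : ℕ → ℝ
  √ s = real (λ k → isqrt (s ℕ.* (suc k ℕ.* suc k)) // suc k) (grid-cauchy a close)
    where
    open ℕ.+-*-Solver
    a : ℕ → ℕ
    a k = isqrt (s ℕ.* (suc k ℕ.* suc k))
    square-< : ∀ {m n} → m ℕ.* m ℕ.< n ℕ.* n → m ℕ.< n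
    square-< {m} {n} h = ℕ.≰⇒> λ n≤m → ℕ.<⇒≱ h (ℕ.*-mono-≤ n≤m n≤m)
    step : ∀ i j → a i ℕ.* suc j ℕ.< suc (a j) ℕ.* suc i
    step i j = square-< (begin-strict
      a i ℕ.* suc j ℕ.* (a i ℕ.* suc j)
        ≡⟨ solve 2 (λ p j → p :* j :* (p :* j) := (p :* p) :* (j :* j)) refl (a i) (suc j) ⟩
      a i ℕ.* a i ℕ.* (suc j ℕ.* suc j)
        ≤⟨ ℕ.*-monoˡ-≤ (suc j ℕ.* suc j) (isqrt-lower (s ℕ.* (suc i ℕ.* suc i))) ⟩
      s ℕ.* (suc i ℕ.* suc i) ℕ.* (suc j ℕ.* suc j)
        ≡⟨ solve 3 (λ s i j → s :* i :* j := s :* j :* i) refl s (suc i ℕ.* suc i) (suc j ℕ.* suc j) ⟩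
      s ℕ.* (suc j ℕ.* suc j) ℕ.* (suc i ℕ.* suc i)
        <⟨ ℕ.*-monoˡ-< (suc i ℕ.* suc i) (isqrt-upper (s ℕ.* (suc j ℕ.* suc j))) ⟩
      suc (a j) ℕ.* suc (a j) ℕ.* (suc i ℕ.* suc i)
        ≡⟨ solve 2 (λ p j → (p :* p) :* (j :* j) := p :* j :* (p :* j)) refl (suc (a j)) (suc i) ⟩
      suc (a j) ℕ.* suc i ℕ.* (suc (a j) ℕ.* suc i) ∎)
      where open ℕ.≤-Reasoning
    close : ∀ m → ∃[ N ] ∀ i j → N ℕ.≤ i → N ℕ.≤ j →
      a i ℕ.* (suc j ℕ.* suc m) ℕ.≤ suc (a j) ℕ.* (suc i ℕ.* suc m) ℕ.+ suc i ℕ.* suc j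
    close m = 0 , λ i j _ _ → begin
      a i ℕ.* (suc j ℕ.* suc m)          ≡⟨ ℕ.*-assoc (a i) (suc j) (suc m) ⟨
      a i ℕ.* suc j ℕ.* suc m            ≤⟨ ℕ.*-monoˡ-≤ (suc m) (ℕ.<⇒≤ (step i j)) ⟩
      suc (a j) ℕ.* suc i ℕ.* suc m      ≡⟨ ℕ.*-assoc (suc (a j)) (suc i) (suc m) ⟩
      suc (a j) ℕ.* (suc i ℕ.* suc m)    ≤⟨ ℕ.m≤m+n _ _ ⟩
      suc (a j) ℕ.* (suc i ℕ.* suc m) ℕ.+ suc i ℕ.* suc j ∎
      where open ℕ.≤-Reasoning

module Log where

  2^⌊log₂n⌋≤n : ∀ n → .{{ℕ.NonZero n}} → 2 ℕ.^ ⌊log₂ n ⌋ ℕ.≤ n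
  2^⌊log₂n⌋≤n n@(suc _) = <-rec (λ n → 1 ℕ.≤ n → 2 ℕ.^ ⌊log₂ n ⌋ ℕ.≤ n) go n (s≤s z≤n)
    where
    go : ∀ n → (∀ {m} → m ℕ.< n → 1 ℕ.≤ m → 2 ℕ.^ ⌊log₂ m ⌋ ℕ.≤ m) → 1 ℕ.≤ n → 2 ℕ.^ ⌊log₂ n ⌋ ℕ.≤ n
    go 1 _ _ = ℕ.≤-refl
    go n@(suc (suc k)) rec _ = begin
      2 ℕ.^ ⌊log₂ n ⌋             ≡⟨ cong (2 ℕ.^_) (ℕ.m+[n∸m]≡n (⌊log₂⌋-mono-≤ {2} {n} (s≤s (s≤s z≤n)))) ⟨
      2 ℕ.* 2 ℕ.^ (⌊log₂ n ⌋ ℕ.∸ 1)  ≡⟨ cong (λ l → 2 ℕ.* 2 ℕ.^ l) (⌊log₂⌊n/2⌋⌋≡⌊log₂n⌋∸1 n) ⟨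
      2 ℕ.* 2 ℕ.^ ⌊log₂ h ⌋       ≤⟨ ℕ.*-monoʳ-≤ 2 (rec (ℕ.⌊n/2⌋<n (suc k)) (ℕ.⌊n/2⌋-mono {2} {n} (s≤s (s≤s z≤n)))) ⟩
      2 ℕ.* h                     ≡⟨ cong (h ℕ.+_) (ℕ.+-identityʳ h) ⟩
      h ℕ.+ h                     ≤⟨ ℕ.+-monoʳ-≤ h (ℕ.⌊n/2⌋≤⌈n/2⌉ n) ⟩
      h ℕ.+ ℕ.⌈ n /2⌉             ≡⟨ ℕ.⌊n/2⌋+⌈n/2⌉≡n n ⟩
      n                           ∎
      where
      open ℕ.≤-Reasoning
      h = ℕ.⌊ n /2⌋

  n<2^[1+⌊log₂n⌋] : ∀ n → n ℕ.< 2 ℕ.^ suc ⌊log₂ n ⌋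
  n<2^[1+⌊log₂n⌋] n = ℕ.≰⇒> λ h → ℕ.1+n≰n
    (ℕ.≤-trans (ℕ.≤-reflexive (sym (⌊log₂[2^n]⌋≡n (suc ⌊log₂ n ⌋)))) (⌊log₂⌋-mono-≤ h))

  [mn]^k : ∀ m n k → (m ℕ.* n) ℕ.^ k ≡ m ℕ.^ k ℕ.* n ℕ.^ k
  [mn]^k m n zero    = refl
  [mn]^k m n (suc k) = trans (cong (m ℕ.* n ℕ.*_) ([mn]^k m n k))
    (solve 4 (λ a b c d → a :* b :* (c :* d) := (a :* c) :* (b :* d)) refl m n (m ℕ.^ k) (n ℕ.^ k))
    where open ℕ.+-*-Solver

  2^-cancel : ∀ {m n} → 2 ℕ.^ m ℕ.≤ 2 ℕ.^ n → m ℕ.≤ n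
  2^-cancel h = ℕ.≮⇒≥ λ n<m → ℕ.<⇒≱ (ℕ.^-monoʳ-< 2 (s≤s (s≤s z≤n)) n<m) h

  -- (1 + 1/h)^j ≤ 1 + 2j/h as long as 2j ≤ h + 2
  bernoulli : ∀ h j → 2 ℕ.* j ℕ.≤ 2 ℕ.+ h → suc h ℕ.^ j ℕ.* h ℕ.≤ h ℕ.^ j ℕ.* (h ℕ.+ 2 ℕ.* j)
  bernoulli h zero    _ = ℕ.≤-reflexive (cong (1 ℕ.*_) (sym (ℕ.+-identityʳ h)))
  bernoulli h (suc j) 2[1+j]≤2+h = begin
    suc h ℕ.* suc h ℕ.^ j ℕ.* h
      ≡⟨ ℕ.*-assoc (suc h) (suc h ℕ.^ j) h ⟩
    suc h ℕ.* (suc h ℕ.^ j ℕ.* h)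
      ≤⟨ ℕ.*-monoʳ-≤ (suc h) (bernoulli h j (ℕ.≤-trans 2j≤h (ℕ.m≤n+m h 2))) ⟩
    suc h ℕ.* (h ℕ.^ j ℕ.* (h ℕ.+ 2 ℕ.* j))
      ≡⟨ solve 3 (λ h j p → (con 1 :+ h) :* (p :* (h :+ con 2 :* j))
                         := p :* (h :* (h :+ con 2 :* j :+ con 1) :+ con 2 :* j)) refl h j (h ℕ.^ j) ⟩
    h ℕ.^ j ℕ.* (h ℕ.* (h ℕ.+ 2 ℕ.* j ℕ.+ 1) ℕ.+ 2 ℕ.* j)
      ≤⟨ ℕ.*-monoʳ-≤ (h ℕ.^ j) (ℕ.+-monoʳ-≤ (h ℕ.* (h ℕ.+ 2 ℕ.* j ℕ.+ 1)) 2j≤h) ⟩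
    h ℕ.^ j ℕ.* (h ℕ.* (h ℕ.+ 2 ℕ.* j ℕ.+ 1) ℕ.+ h)
      ≡⟨ solve 3 (λ h j p → p :* (h :* (h :+ con 2 :* j :+ con 1) :+ h)
                         := h :* p :* (h :+ con 2 :* (con 1 :+ j))) refl h j (h ℕ.^ j) ⟩
    h ℕ.* h ℕ.^ j ℕ.* (h ℕ.+ 2 ℕ.* suc j) ∎
    where
    open ℕ.≤-Reasoning
    open ℕ.+-*-Solver
    2j≤h : 2 ℕ.* j ℕ.≤ h
    2j≤h = ℕ.+-cancelˡ-≤ 2 (2 ℕ.* j) h (ℕ.≤-trans (ℕ.≤-reflexive
      (solve 1 (λ j → con 2 :+ con 2 :* j := con 2 :* (con 1 :+ j)) refl j)) 2[1+j]≤2+h)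

  doubling : ∀ m → .{{ℕ.NonZero m}} → suc (2 ℕ.* m) ℕ.^ m ℕ.≤ 2 ℕ.* (2 ℕ.* m) ℕ.^ m
  doubling m@(suc _) = ℕ.*-cancelʳ-≤ _ _ h (begin
    suc h ℕ.^ m ℕ.* h             ≤⟨ bernoulli h m (ℕ.m≤n+m h 2) ⟩
    h ℕ.^ m ℕ.* (h ℕ.+ h)         ≡⟨ solve 2 (λ p h → p :* (h :+ h) := con 2 :* p :* h) refl (h ℕ.^ m) h ⟩
    2 ℕ.* h ℕ.^ m ℕ.* h           ∎)
    where
    open ℕ.≤-Reasoning
    open ℕ.+-*-Solver
    h = 2 ℕ.* m

  -- From 2^P ≤ (a/b)^I, (c/d)^J ≤ 2^Q, a/b ≤ (c/d) (1 + 1/h) and (1 + 1/h)^m ≤ 2: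
  -- P/I ≤ Q/J + 1/m.
  compare : ∀ {P Q a b c d h} I J m .{{_ : ℕ.NonZero b}} .{{_ : ℕ.NonZero d}} .{{_ : ℕ.NonZero h}} →
    2 ℕ.^ P ℕ.* b ℕ.^ I ℕ.≤ a ℕ.^ I →
    c ℕ.^ J ℕ.≤ 2 ℕ.^ Q ℕ.* d ℕ.^ J →
    a ℕ.* (d ℕ.* h) ℕ.≤ c ℕ.* (b ℕ.* suc h) →
    suc h ℕ.^ m ℕ.≤ 2 ℕ.* h ℕ.^ m →
    P ℕ.* (J ℕ.* m) ℕ.≤ Q ℕ.* (I ℕ.* m) ℕ.+ I ℕ.* J
  compare {P} {Q} {a} {b} {c} {d} {h} I J m lower upper near dbl =
    2^-cancel (ℕ.*-cancelʳ-≤ _ _ (b ℕ.^ N ℕ.* (d ℕ.^ N ℕ.* h ℕ.^ N)) {{≢0}} (begin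
    2 ℕ.^ (P ℕ.* (J ℕ.* m)) ℕ.* (b ℕ.^ N ℕ.* (d ℕ.^ N ℕ.* h ℕ.^ N))
      ≡⟨ ℕ.*-assoc (2 ℕ.^ (P ℕ.* (J ℕ.* m))) (b ℕ.^ N) _ ⟨
    2 ℕ.^ (P ℕ.* (J ℕ.* m)) ℕ.* b ℕ.^ N ℕ.* (d ℕ.^ N ℕ.* h ℕ.^ N)
      ≡⟨ cong₂ ℕ._*_ (sym (power 2 b P I (J ℕ.* m))) (sym ([mn]^k d h N)) ⟩
    (2 ℕ.^ P ℕ.* b ℕ.^ I) ℕ.^ (J ℕ.* m) ℕ.* (d ℕ.* h) ℕ.^ N
      ≤⟨ ℕ.*-monoˡ-≤ ((d ℕ.* h) ℕ.^ N) (ℕ.^-monoˡ-≤ (J ℕ.* m) lower) ⟩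
    (a ℕ.^ I) ℕ.^ (J ℕ.* m) ℕ.* (d ℕ.* h) ℕ.^ N
      ≡⟨ cong (ℕ._* (d ℕ.* h) ℕ.^ N) (ℕ.^-*-assoc a I (J ℕ.* m)) ⟩
    a ℕ.^ N ℕ.* (d ℕ.* h) ℕ.^ N
      ≡⟨ [mn]^k a (d ℕ.* h) N ⟨
    (a ℕ.* (d ℕ.* h)) ℕ.^ N
      ≤⟨ ℕ.^-monoˡ-≤ N near ⟩
    (c ℕ.* (b ℕ.* suc h)) ℕ.^ N
      ≡⟨ trans ([mn]^k c (b ℕ.* suc h) N) (cong (c ℕ.^ N ℕ.*_) ([mn]^k b (suc h) N)) ⟩
    c ℕ.^ N ℕ.* (b ℕ.^ N ℕ.* suc h ℕ.^ N)
      ≡⟨ cong₂ (λ u v → u ℕ.* (b ℕ.^ N ℕ.* v))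
           (trans (cong (c ℕ.^_) N≡J) (sym (ℕ.^-*-assoc c J (I ℕ.* m))))
           (trans (cong (suc h ℕ.^_) N≡m) (sym (ℕ.^-*-assoc (suc h) m (I ℕ.* J)))) ⟩
    (c ℕ.^ J) ℕ.^ (I ℕ.* m) ℕ.* (b ℕ.^ N ℕ.* (suc h ℕ.^ m) ℕ.^ (I ℕ.* J))
      ≤⟨ ℕ.*-mono-≤ (ℕ.^-monoˡ-≤ (I ℕ.* m) upper)
           (ℕ.*-monoʳ-≤ (b ℕ.^ N) (ℕ.^-monoˡ-≤ (I ℕ.* J) dbl)) ⟩
    (2 ℕ.^ Q ℕ.* d ℕ.^ J) ℕ.^ (I ℕ.* m) ℕ.* (b ℕ.^ N ℕ.* (2 ℕ.* h ℕ.^ m) ℕ.^ (I ℕ.* J))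
      ≡⟨ cong₂ (λ u v → u ℕ.* (b ℕ.^ N ℕ.* v))
           (trans (power 2 d Q J (I ℕ.* m)) (cong (λ e → 2 ℕ.^ (Q ℕ.* (I ℕ.* m)) ℕ.* d ℕ.^ e) (sym N≡J)))
           (trans ([mn]^k 2 (h ℕ.^ m) (I ℕ.* J)) (cong (2 ℕ.^ (I ℕ.* J) ℕ.*_)
             (trans (ℕ.^-*-assoc h m (I ℕ.* J)) (cong (h ℕ.^_) (sym N≡m))))) ⟩
    2 ℕ.^ (Q ℕ.* (I ℕ.* m)) ℕ.* d ℕ.^ N ℕ.* (b ℕ.^ N ℕ.* (2 ℕ.^ (I ℕ.* J) ℕ.* h ℕ.^ N))
      ≡⟨ solve 5 (λ x d b y h → x :* d :* (b :* (y :* h)) := x :* y :* (b :* (d :* h))) refl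
           (2 ℕ.^ (Q ℕ.* (I ℕ.* m))) (d ℕ.^ N) (b ℕ.^ N) (2 ℕ.^ (I ℕ.* J)) (h ℕ.^ N) ⟩
    2 ℕ.^ (Q ℕ.* (I ℕ.* m)) ℕ.* 2 ℕ.^ (I ℕ.* J) ℕ.* (b ℕ.^ N ℕ.* (d ℕ.^ N ℕ.* h ℕ.^ N))
      ≡⟨ cong (ℕ._* (b ℕ.^ N ℕ.* (d ℕ.^ N ℕ.* h ℕ.^ N))) (ℕ.^-distribˡ-+-* 2 (Q ℕ.* (I ℕ.* m)) (I ℕ.* J)) ⟨
    2 ℕ.^ (Q ℕ.* (I ℕ.* m) ℕ.+ I ℕ.* J) ℕ.* (b ℕ.^ N ℕ.* (d ℕ.^ N ℕ.* h ℕ.^ N)) ∎))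
    where
    open ℕ.≤-Reasoning
    open ℕ.+-*-Solver
    N = I ℕ.* (J ℕ.* m)
    N≡J : N ≡ J ℕ.* (I ℕ.* m)
    N≡J = solve 3 (λ i j m → i :* (j :* m) := j :* (i :* m)) refl I J m
    N≡m : N ≡ m ℕ.* (I ℕ.* J)
    N≡m = solve 3 (λ i j m → i :* (j :* m) := m :* (i :* j)) refl I J m
    power : ∀ x y p i e → (x ℕ.^ p ℕ.* y ℕ.^ i) ℕ.^ e ≡ x ℕ.^ (p ℕ.* e) ℕ.* y ℕ.^ (i ℕ.* e)
    power x y p i e = trans ([mn]^k (x ℕ.^ p) (y ℕ.^ i) e)
      (cong₂ ℕ._*_ (ℕ.^-*-assoc x p e) (ℕ.^-*-assoc y i e))
    ≢0 : ℕ.NonZero (b ℕ.^ N ℕ.* (d ℕ.^ N ℕ.* h ℕ.^ N))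
    ≢0 = ℕ.m*n≢0 (b ℕ.^ N) _ {{ℕ.m^n≢0 b N}} {{ℕ.m*n≢0 (d ℕ.^ N) _ {{ℕ.m^n≢0 d N}} {{ℕ.m^n≢0 h N}}}}

  -- For q ≥ 0.
  ⌊_^_⌋ : ℚ → ℕ → ℕ
  ⌊ q ^ k ⌋ = (ℤ.∣ ℚ.↥ q ∣ ℕ.^ k ℕ./ ℚ.↧ₙ q ℕ.^ k) {{ℕ.m^n≢0 (ℚ.↧ₙ q) k}}

  numerator-≥ : ∀ e q → (e // 1) ℚ.≤ q → e ℕ.* ℚ.↧ₙ q ℕ.≤ ℤ.∣ ℚ.↥ q ∣
  numerator-≥ e q@(ℚ.mkℚ (ℤ.+ n) d _) h = ℕ.≤-trans
    (//-mono⁻¹ {e} {n} 0 d (ℚ.≤-trans h (ℚ.≤-reflexive (sym (ℚ.↥p/↧p≡p q)))))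
    (ℕ.≤-reflexive (ℕ.*-identityʳ n))
  numerator-≥ e q@(ℚ.mkℚ (ℤ.-[1+ n ]) d _) h
    with () ← ℚ.drop-*≤* (ℚ.≤-trans (//-mono {0} {e} 0 0 z≤n) h)

  ∣↥∣//↧ : ∀ q → 0ℚ ℚ.≤ q → ℤ.∣ ℚ.↥ q ∣ // ℚ.↧ₙ q ≡ q
  ∣↥∣//↧ q@(ℚ.mkℚ (ℤ.+ n) d _) _ = ℚ.↥p/↧p≡p q
  ∣↥∣//↧ q@(ℚ.mkℚ (ℤ.-[1+ n ]) d _) h with () ← ℚ.nonNegative h

  ⌊^⌋-lower : ∀ q k → ⌊ q ^ k ⌋ ℕ.* ℚ.↧ₙ q ℕ.^ k ℕ.≤ ℤ.∣ ℚ.↥ q ∣ ℕ.^ k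
  ⌊^⌋-lower q k = ℕ.m/n*n≤m _ (ℚ.↧ₙ q ℕ.^ k) {{ℕ.m^n≢0 (ℚ.↧ₙ q) k}}

  ⌊^⌋-upper : ∀ q k → ℤ.∣ ℚ.↥ q ∣ ℕ.^ k ℕ.≤ suc ⌊ q ^ k ⌋ ℕ.* ℚ.↧ₙ q ℕ.^ k
  ⌊^⌋-upper q k = begin
    a ≡⟨ ℕ.m≡m%n+[m/n]*n a b ⟩
    a ℕ.% b ℕ.+ a ℕ./ b ℕ.* b ≤⟨ ℕ.+-monoˡ-≤ (a ℕ./ b ℕ.* b) (ℕ.<⇒≤ (ℕ.m%n<n a b)) ⟩
    b ℕ.+ a ℕ./ b ℕ.* b ∎
    where
    open ℕ.≤-Reasoning
    a = ℤ.∣ ℚ.↥ q ∣ ℕ.^ k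
    b = ℚ.↧ₙ q ℕ.^ k
    instance
      b≢0 : ℕ.NonZero b
      b≢0 = ℕ.m^n≢0 (ℚ.↧ₙ q) k

  e^k≤⌊q^k⌋ : ∀ e q k → (e // 1) ℚ.≤ q → e ℕ.^ k ℕ.≤ ⌊ q ^ k ⌋
  e^k≤⌊q^k⌋ e q k h = begin
    e ℕ.^ k                                  ≡⟨ ℕ.m*n/n≡m (e ℕ.^ k) b ⟨
    (e ℕ.^ k ℕ.* b) ℕ./ b                    ≡⟨ cong (ℕ._/ b) ([mn]^k e (ℚ.↧ₙ q) k) ⟨
    (e ℕ.* ℚ.↧ₙ q) ℕ.^ k ℕ./ b               ≤⟨ ℕ./-monoˡ-≤ b (ℕ.^-monoˡ-≤ k (numerator-≥ e q h)) ⟩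
    ⌊ q ^ k ⌋                                ∎
    where
    open ℕ.≤-Reasoning
    b = ℚ.↧ₙ q ℕ.^ k
    instance
      b≢0 : ℕ.NonZero b
      b≢0 = ℕ.m^n≢0 (ℚ.↧ₙ q) k

open Log

-- Approximants ⌊ log₂ (x_k ^ k) ⌋ / k. Terms below 1 are replaced by 1, so log₂ x
-- is the binary logarithm of max(x, 1).
log₂-term : (ℕ → ℚ) → ℕ → ℕ
log₂-term x k = ⌊log₂ ⌊ x k ℚ.⊔ 1ℚ ^ suc k ⌋ ⌋

log₂-close : ∀ x → Cauchy x → ∀ m → ∃[ N ] ∀ i j → N ℕ.≤ i → N ℕ.≤ j →
  log₂-term x i ℕ.* (suc j ℕ.* suc m) ℕ.≤ suc (log₂-term x j) ℕ.* (suc i ℕ.* suc m) ℕ.+ suc i ℕ.* suc j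
log₂-close x x-cauchy m = proj₁ eventually , λ i j N≤i N≤j →
  compare {log₂-term x i} {suc (log₂-term x j)} {num i} {den i} {num j} {den j} {h}
    (suc i) (suc j) (suc m) (lower i) (upper j)
    (near i j (dist-elim (proj₂ eventually i j N≤i N≤j))) (doubling (suc m))
  where
  h-1 = m ℕ.+ 1 ℕ.* suc m
  h = suc h-1
  eventually = x-cauchy (1 // h) (ℚ.positive⁻¹ (1 // h) {{ℚ.normalize-pos 1 h}})
  y : ℕ → ℚ
  y k = x k ℚ.⊔ 1ℚ
  num den : ℕ → ℕ
  num k = ℤ.∣ ℚ.↥ y k ∣
  den k = ℚ.↧ₙ (y k)
  1≤y : ∀ k → 1ℚ ℚ.≤ y k
  1≤y k = ℚ.p≤q⊔p (x k) 1ℚ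
  ⌊y^⌋≢0 : ∀ k → ℕ.NonZero ⌊ y k ^ suc k ⌋
  ⌊y^⌋≢0 k = ℕ.>-nonZero (ℕ.≤-trans (ℕ.≤-reflexive (sym (ℕ.^-zeroˡ (suc k)))) (e^k≤⌊q^k⌋ 1 (y k) (suc k) (1≤y k)))
  0≤y : ∀ k → 0ℚ ℚ.≤ y k
  0≤y k = ℚ.≤-trans (ℚ.nonNegative⁻¹ 1ℚ) (1≤y k)
  num//den : ∀ k → num k // den k ≡ y k
  num//den k = ∣↥∣//↧ (y k) (0≤y k)
  ≤y+1/h : ∀ k → y k ℚ.≤ y k ℚ.+ (1 // h)
  ≤y+1/h k = ℚ.≤-trans (ℚ.≤-reflexive (sym (ℚ.+-identityʳ (y k))))
    (ℚ.+-monoʳ-≤ (y k) (ℚ.nonNegative⁻¹ (1 // h) {{ℚ.normalize-nonNeg 1 h}}))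
  1+1/h : 1ℚ ℚ.+ (1 // h) ℚ.≤ (suc h // h)
  1+1/h = ℚ.≤-trans (ℚ.≤-reflexive (//-+ 1 1 0 h-1)) (//-mono {1 ℕ.* h ℕ.+ 1} {suc h} (h-1 ℕ.+ 0) h-1
    (ℕ.≤-reflexive (solve 1 (λ h → (con 1 :* h :+ con 1) :* h := (con 1 :+ h) :* (con 1 :* h)) refl h)))
    where open ℕ.+-*-Solver
  lower : ∀ k → 2 ℕ.^ log₂-term x k ℕ.* den k ℕ.^ suc k ℕ.≤ num k ℕ.^ suc k
  lower k = ℕ.≤-trans (ℕ.*-monoˡ-≤ (den k ℕ.^ suc k) (2^⌊log₂n⌋≤n ⌊ y k ^ suc k ⌋ {{⌊y^⌋≢0 k}}))
    (⌊^⌋-lower (y k) (suc k))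
  upper : ∀ k → num k ℕ.^ suc k ℕ.≤ 2 ℕ.^ suc (log₂-term x k) ℕ.* den k ℕ.^ suc k
  upper k = ℕ.≤-trans (⌊^⌋-upper (y k) (suc k))
    (ℕ.*-monoˡ-≤ (den k ℕ.^ suc k) (n<2^[1+⌊log₂n⌋] ⌊ y k ^ suc k ⌋))
  near : ∀ i j → x i ℚ.≤ x j ℚ.+ (1 // h) → num i ℕ.* (den j ℕ.* h) ℕ.≤ num j ℕ.* (den i ℕ.* suc h)
  near i j xᵢ≤ = ℕ.≤-trans (//-mono⁻¹ {num i} {num j ℕ.* suc h} (ℚ.denominator-1 (y i)) _ (begin
    num i // den i                   ≡⟨ num//den i ⟩
    y i                              ≤⟨ ℚ.⊔-lub (ℚ.≤-trans xᵢ≤ (ℚ.+-monoˡ-≤ (1 // h) (ℚ.p≤p⊔q (x j) 1ℚ)))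
                                                (ℚ.≤-trans (1≤y j) (≤y+1/h j)) ⟩
    y j ℚ.+ (1 // h)                 ≤⟨ ℚ.+-monoʳ-≤ (y j) (ℚ.≤-trans (ℚ.≤-reflexive (sym (ℚ.*-identityˡ (1 // h))))
                                          (ℚ.*-monoʳ-≤-nonNeg (1 // h) {{ℚ.normalize-nonNeg 1 h}} (1≤y j))) ⟩
    y j ℚ.+ y j ℚ.* (1 // h)         ≡⟨ cong (ℚ._+ y j ℚ.* (1 // h)) (ℚ.*-identityʳ (y j)) ⟨
    y j ℚ.* 1ℚ ℚ.+ y j ℚ.* (1 // h)  ≡⟨ ℚ.*-distribˡ-+ (y j) 1ℚ (1 // h) ⟨
    y j ℚ.* (1ℚ ℚ.+ (1 // h))        ≤⟨ ℚ.*-monoˡ-≤-nonNeg (y j) {{ℚ.nonNegative (0≤y j)}} 1+1/h ⟩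
    y j ℚ.* (suc h // h)             ≡⟨ cong (ℚ._* (suc h // h)) (num//den j) ⟨
    (num j // den j) ℚ.* (suc h // h) ≡⟨ //-* (num j) (suc h) (ℚ.denominator-1 (y j)) h-1 ⟩
    (num j ℕ.* suc h) // (den j ℕ.* h) ∎))
    (ℕ.≤-reflexive reassoc)
    where
    open ℚ.≤-Reasoning
    reassoc : num j ℕ.* suc h ℕ.* den i ≡ num j ℕ.* (den i ℕ.* suc h)
    reassoc = trans (ℕ.*-assoc (num j) (suc h) (den i)) (cong (num j ℕ.*_) (ℕ.*-comm (suc h) (den i)))

opaque
  log₂ : ℝ → ℝ
  log₂ x = real (λ k → log₂-term (seq x) k // suc k)
    (grid-cauchy (log₂-term (seq x)) (log₂-close (seq x) (cauchy x)))

opaque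
  unfolding log₂

  log₂-≥ : ∀ x e → (∀ k → ((2 ℕ.^ e) // 1) ℚ.≤ seq x k) → ∀ k → (e // 1) ℚ.≤ seq (log₂ x) k
  log₂-≥ x e 2^e≤x k = //-mono {e} {log₂-term (seq x) k} 0 k (begin
    e ℕ.* suc k                                  ≡⟨ ⌊log₂[2^n]⌋≡n (e ℕ.* suc k) ⟨
    ⌊log₂ 2 ℕ.^ (e ℕ.* suc k) ⌋                  ≡⟨ cong ⌊log₂_⌋ (ℕ.^-*-assoc 2 e (suc k)) ⟨
    ⌊log₂ (2 ℕ.^ e) ℕ.^ suc k ⌋                  ≤⟨ ⌊log₂⌋-mono-≤ (e^k≤⌊q^k⌋ (2 ℕ.^ e) _ (suc k)
                                                      (ℚ.≤-trans (2^e≤x k) (ℚ.p≤p⊔q (seq x k) 1ℚ))) ⟩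
    log₂-term (seq x) k                          ≡⟨ ℕ.*-identityʳ _ ⟨
    log₂-term (seq x) k ℕ.* 1 ∎)
    where open ℕ.≤-Reasoning

opaque
  unfolding fromℚ

  0<log₂log₂ : ∀ {n} → 4 ℕ.≤ n → 0ℝ < log₂ (log₂ (fromℕ n))
  0<log₂log₂ {n} 4≤n = 1ℚ , ℚ.positive⁻¹ 1ℚ , 0 , λ k _ →
    ℚ.≤-trans (ℚ.≤-reflexive (ℚ.+-identityˡ 1ℚ))
      (log₂-≥ (log₂ (fromℕ n)) 1 (log₂-≥ (fromℕ n) 2 λ _ → //-mono {4} {n} 0 0 (ℕ.*-monoˡ-≤ 1 4≤n)) k)
opaque
  unfolding fromℚ _+_ -_ ∣_∣ _*_ recip √ log₂

  seq-fromℚ : ∀ q n → seq (fromℚ q) n ≡ q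
  seq-fromℚ _ _ = refl

  seq-+ : ∀ x y n → seq (x + y) n ≡ seq x n ℚ.+ seq y n
  seq-+ _ _ _ = refl

  seq-neg : ∀ x n → seq (- x) n ≡ ℚ.- seq x n
  seq-neg _ _ = refl

  seq-∣∣ : ∀ x n → seq ∣ x ∣ n ≡ ℚ.∣ seq x n ∣
  seq-∣∣ _ _ = refl

  seq-* : ∀ x y n → seq (x * y) n ≡ seq x n ℚ.* seq y n
  seq-* _ _ _ = refl

  seq-recip : ∀ x (0<x : 0ℝ < x) n → seq (recip x 0<x) n ℚ.* (seq x n ℚ.⊔ proj₁ 0<x) ≡ 1ℚ
  seq-recip x (δ , 0<δ , _) n = 1/-inv (seq x n ℚ.⊔ δ) (ℚ.<-≤-trans 0<δ (ℚ.p≤q⊔p (seq x n) δ))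

  seq-√ : ∀ s k → seq (√ s) k ≡ isqrt (s ℕ.* (suc k ℕ.* suc k)) // suc k
  seq-√ _ _ = refl

  seq-log₂ : ∀ x k → seq (log₂ x) k ≡ log₂-term (seq x) k // suc k
  seq-log₂ _ _ = refl

∑ : ∀ {n} → (Fin n → ℝ) → ℝ
∑ = Vector.foldr _+_ 0ℝ

_⟶_ : (ℕ → ℝ) → ℝ → Set
x ⟶ l = ∀ ε → 0ℝ < ε → ∃[ N ] ∀ n → N ℕ.≤ n → ∣ x n - l ∣ ≤ ε

-- Probability is axiomatised through the expectation of integrable real random
-- variables (a normalised Daniell integral). By the Daniell–Stone theorem these
-- are the expectations with respect to a probability measure; conversely every
-- probability space with its integrable random variables is an instance.
record ProbabilitySpace : Set₁ where
  field
    Ω          : Set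
    Integrable : (Ω → ℝ) → Set
    𝔼          : ∀ {X : Ω → ℝ} → Integrable X → ℝ

    integrable-resp  : ∀ {X Y : Ω → ℝ} → (∀ ω → X ω ≈ Y ω) → Integrable X → Integrable Y
    integrable-const : ∀ a → Integrable (λ _ → a)
    integrable-+     : ∀ {X Y : Ω → ℝ} → Integrable X → Integrable Y → Integrable (λ ω → X ω + Y ω)
    integrable-*     : ∀ a {X : Ω → ℝ} → Integrable X → Integrable (λ ω → a * X ω)
    integrable-∣∣    : ∀ {X : Ω → ℝ} → Integrable X → Integrable (λ ω → ∣ X ω ∣)

    𝔼-const : ∀ a → 𝔼 (integrable-const a) ≈ a
    𝔼-+     : ∀ {X Y : Ω → ℝ} (i : Integrable X) (j : Integrable Y) → 𝔼 (integrable-+ i j) ≈ 𝔼 i + 𝔼 j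
    𝔼-*     : ∀ a {X : Ω → ℝ} (i : Integrable X) → 𝔼 (integrable-* a i) ≈ a * 𝔼 i
    𝔼-mono  : ∀ {X Y : Ω → ℝ} (i : Integrable X) (j : Integrable Y) → (∀ ω → X ω ≤ Y ω) → 𝔼 i ≤ 𝔼 j
    𝔼-continuous : ∀ {X : ℕ → Ω → ℝ} (i : ∀ n → Integrable (X n)) →
      (∀ n ω → X (suc n) ω ≤ X n ω) → (∀ ω → (λ n → X n ω) ⟶ 0ℝ) → (λ n → 𝔼 (i n)) ⟶ 0ℝ

-- The commodity set is Fin s.
module OMFLP (s : ℕ) .{{_ : ℕ.NonZero s}} where

  -- The part of an instance that is known in advance.
  record Environment : Set where
    field
      points      : ℕ
      d           : Fin points → Fin points → ℝ
      isMetric    : IsGeneralMetric _≡_ _≈_ _≤_ 0ℝ _+_ d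
      f           : Fin points → Subset s → ℝ
      nonNegative : ∀ m σ → 0ℝ ≤ f m σ
      subadditive : ∀ m a b → f m (a ∪ b) ≤ f m a + f m b
      average     : ∀ m σ → .{{_ : ℕ.NonZero Subset.∣ σ ∣}} → f m ⊤ /ℕ s ≤ f m σ /ℕ Subset.∣ σ ∣

  module _ (E : Environment) where
    open Environment E

    OnLine : Set
    OnLine = Σ[ position ∈ (Fin points → ℝ) ] ∀ i j → d i j ≈ ∣ position i - position j ∣

    record Request : Set where
      field
        location : Fin points
        demand   : Subset s
        nonempty : Nonempty demand

    open Request

    Facility : Set
    Facility = Fin points × Subset s

    constructionCost : List Facility → ℝ
    constructionCost = List.foldr (λ (m , σ) → f m σ +_) 0ℝ

    -- An assignment is a set of indices into the list of facilities.
    Serves : (fs : List Facility) → Subset (length fs) → Request → Set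
    Serves fs A r = ∀ {e} → e ∈ demand r → ∃[ i ] i ∈ A × e ∈ proj₂ (List.lookup fs i)

    assignmentCost : (fs : List Facility) → Subset (length fs) → Request → ℝ
    assignmentCost fs A r =
      ∑ λ i → if Vec.lookup A i then d (proj₁ (List.lookup fs i)) (location r) else 0ℝ

    record Solution (rs : List Request) : Set where
      field
        facilities : List Facility
        assigned   : Fin (length rs) → Subset (length facilities)
        serves     : ∀ j → Serves facilities (assigned j) (List.lookup rs j)

      cost : ℝ
      cost = constructionCost facilities
           + ∑ λ j → assignmentCost facilities (assigned j) (List.lookup rs j)

    IsOPT : List Request → ℝ → Set
    IsOPT rs v = (∃[ S ] Solution.cost {rs} S ≈ v) × (∀ S → v ≤ Solution.cost {rs} S)

    allOpened : (Request → List Request → List Facility) → List Request → List Facility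
    allOpened opens []      = []
    allOpened opens (r ∷ h) = opens r h ++ allOpened opens h

    -- Request sequences are written with the latest request first: on arrival of r
    -- after the requests h, the algorithm sees r and h only.
    record OnlineAlgorithm : Set where
      field
        opens : Request → List Request → List Facility

      opened : List Request → List Facility
      opened = allOpened opens

      field
        assigned : ∀ r h → Subset (length (opened (r ∷ h)))
        serves   : ∀ r h → Serves (opened (r ∷ h)) (assigned r h) r

      totalAssignmentCost : List Request → ℝ
      totalAssignmentCost []      = 0ℝ
      totalAssignmentCost (r ∷ h) =
        assignmentCost (opened (r ∷ h)) (assigned r h) r + totalAssignmentCost h

      cost : List Request → ℝ
      cost rs = constructionCost (opened rs) + totalAssignmentCost rs

  record RandomizedAlgorithm : Set₁ where
    field
      space : ProbabilitySpace

    open ProbabilitySpace space public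

    field
      algorithm : Ω → (E : Environment) → OnlineAlgorithm E

    cost : (E : Environment) → List (Request E) → Ω → ℝ
    cost E rs ω = OnlineAlgorithm.cost (algorithm ω E) rs

  CompetitiveOnLines : RandomizedAlgorithm → (ℕ → ℕ → ℝ) → Set
  CompetitiveOnLines A c =
    Σ[ a ∈ ℝ ] ∀ E → OnLine E → ∀ rs v → IsOPT E rs v →
      Σ[ i ∈ Integrable (cost E rs) ] 𝔼 i ≤ c s (length rs) * v + a
    where open RandomizedAlgorithm A

{-# OPTIONS --safe #-}
module Submission where

-- Since s is fixed while n grows, √ s is eventually dominated by log n / log log n,
-- so Fotakis' lower bound for facility location on the line suffices. All facilities
-- cost F and all requests demand every commodity. The adversary descends h levels
-- through nested balls, the radius shrinking by a factor q ≥ h per level. The ball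
-- with k levels below it has radius q ^ k; it receives q ^ (h - k) requests at its
-- center, and then one of two disjoint sub-balls is chosen at random. If the ball
-- contains no facility by then, the requests pay F. Otherwise, with
-- probability at least 1/2, it contains a facility outside the chosen sub-ball. So
-- every level costs the algorithm at least F / 2 in expectation, whereas a single
-- facility at the final center serves all requests for a total of at most 4 F. Taking
-- q ^ h ≤ n gives h of order log n / log log n.
--
-- The conclusion is an inequality of reals, hence stable under double negation, so
-- classical reasoning (such as the existence of an optimal solution) is available.

open import Defs
open import Data.Bool.Base using (Bool; true; false; if_then_else_)
open import Data.Empty using (⊥-elim)
open import Data.Fin.Base as Fin using (Fin; toℕ; fromℕ<)
import Data.Fin.Properties as Fin
open import Data.Fin.Subset as Subset using (Subset; ⊤; Nonempty)
import Data.Fin.Subset.Properties as Subset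
import Data.Integer.Base as ℤ
open import Data.List.Base using (List; []; _∷_; length; lookup; map; _++_; replicate)
open import Data.List.Membership.Propositional.Properties using (∈-lookup)
import Data.List.Properties as List
open import Data.List.Relation.Unary.All as All using (All; []; _∷_)
import Data.List.Relation.Unary.All.Properties as All
open import Data.Nat.Base as ℕ using (ℕ; NonZero; zero; suc; z≤n; s≤s)
import Data.Nat.DivMod as ℕ
open import Data.Nat.ListAction using (sum)
open import Data.Nat.ListAction.Properties using (sum-++)
open import Data.Nat.Logarithm using (⌊log₂_⌋; ⌊log₂⌋-mono-≤; ⌊log₂[2^n]⌋≡n)
import Data.Nat.Properties as ℕ
open import Data.Nat.Tactic.RingSolver using (solve-∀)
open import Data.Product.Base using (Σ-syntax; ∃-syntax; _×_; _,_; proj₁; proj₂)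
open import Data.Rational.Base as ℚ using (ℚ; 0ℚ; 1ℚ; ½)
import Data.Rational.Properties as ℚ
open import Data.Rational.Solver using (module +-*-Solver)
open import Data.Sum.Base using (_⊎_; inj₁; inj₂)
open import Data.Vec.Base as Vec using (Vec; []; _∷_)
import Data.Vec.Functional as Vector
import Data.Vec.Properties as Vec
open import Relation.Binary.PropositionalEquality using (_≡_; refl; sym; trans; cong; cong₂; subst; subst₂; isEquivalence; module ≡-Reasoning)
open import Relation.Binary.Structures using (IsEquivalence)
open import Relation.Nullary using (¬_; yes; no)
open ℚ-Lemmas
open Frac
open Log

-- Real numbers

p≤p+ε : ∀ {ε} p → 0ℚ ℚ.< ε → p ℚ.≤ p ℚ.+ ε
p≤p+ε p 0<ε = ℚ.≤-trans (ℚ.≤-reflexive (sym (ℚ.+-identityʳ p))) (ℚ.+-monoʳ-≤ p (ℚ.<⇒≤ 0<ε))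

seq-≤⇒≤ : ∀ {x y} → (∀ n → seq x n ℚ.≤ seq y n) → x ≤ y
seq-≤⇒≤ {x} {y} h ε 0<ε = 0 , λ n _ → ℚ.≤-trans (h n) (p≤p+ε (seq y n) 0<ε)

seq-≡⇒≈ : ∀ {x y} → (∀ n → seq x n ≡ seq y n) → x ≈ y
seq-≡⇒≈ {x} {y} h =
  seq-≤⇒≤ {x} {y} (λ n → ℚ.≤-reflexive (h n)) , seq-≤⇒≤ {y} {x} (λ n → ℚ.≤-reflexive (sym (h n)))

-- From some index on, both sequences stay within ε/4 of their values at that index, where the
-- rationals can be compared. Either the comparison gives `y ≤ x` up to ε, or the gap of ε/2 that it
-- reveals absorbs both errors and yields `x ≤ y`, a contradiction.
≰⇒≥ : ∀ {x y} → ¬ (x ≤ y) → y ≤ x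
≰⇒≥ {x} {y} x≰y ε 0<ε
  with M , f ← cauchy x (½ ℚ.* (½ ℚ.* ε)) (½-pos (½-pos 0<ε))
  with N , g ← cauchy y (½ ℚ.* (½ ℚ.* ε)) (½-pos (½-pos 0<ε))
  = compare-at (M ℕ.⊔ N) (ℕ.m≤m⊔n M N) (ℕ.m≤n⊔m M N)
  where
  open ℚ.≤-Reasoning
  open +-*-Solver
  η = ½ ℚ.* (½ ℚ.* ε)
  compare-at : ∀ k → M ℕ.≤ k → N ℕ.≤ k → ∃[ L ] ∀ n → L ℕ.≤ n → seq y n ℚ.≤ seq x n ℚ.+ ε
  compare-at k M≤k N≤k with seq y k ℚ.≤? seq x k ℚ.+ ½ ℚ.* ε
  ... | yes h = k , λ n k≤n → begin
    seq y n
      ≤⟨ dist-elim {seq y n} {seq y k} (g n k (ℕ.≤-trans N≤k k≤n) N≤k) ⟩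
    seq y k ℚ.+ η
      ≤⟨ ℚ.+-monoˡ-≤ η h ⟩
    seq x k ℚ.+ ½ ℚ.* ε ℚ.+ η
      ≤⟨ ℚ.+-monoˡ-≤ η (ℚ.+-monoˡ-≤ (½ ℚ.* ε) (dist-elim {seq x k} {seq x n} (f k n M≤k (ℕ.≤-trans M≤k k≤n)))) ⟩
    seq x n ℚ.+ η ℚ.+ ½ ℚ.* ε ℚ.+ η
      ≡⟨ solve 3 (λ x h e → x :+ h :+ e :+ h := x :+ ((h :+ h) :+ e)) refl (seq x n) η (½ ℚ.* ε) ⟩
    seq x n ℚ.+ ((η ℚ.+ η) ℚ.+ ½ ℚ.* ε)
      ≡⟨ cong (λ u → seq x n ℚ.+ (u ℚ.+ ½ ℚ.* ε)) (½+½ (½ ℚ.* ε)) ⟩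
    seq x n ℚ.+ (½ ℚ.* ε ℚ.+ ½ ℚ.* ε)
      ≡⟨ cong (seq x n ℚ.+_) (½+½ ε) ⟩
    seq x n ℚ.+ ε ∎
  ... | no ¬h = ⊥-elim (x≰y λ δ 0<δ → k , λ n k≤n → begin
    seq x n
      ≤⟨ dist-elim {seq x n} {seq x k} (f n k (ℕ.≤-trans M≤k k≤n) M≤k) ⟩
    seq x k ℚ.+ η
      ≡⟨ solve 2 (λ x h → x :+ h := x :+ (h :+ h) :- h) refl (seq x k) η ⟩
    seq x k ℚ.+ (η ℚ.+ η) ℚ.- η
      ≡⟨ cong (λ u → seq x k ℚ.+ u ℚ.- η) (½+½ (½ ℚ.* ε)) ⟩
    seq x k ℚ.+ ½ ℚ.* ε ℚ.- η
      ≤⟨ ℚ.+-monoˡ-≤ (ℚ.- η) (ℚ.<⇒≤ (ℚ.≰⇒> ¬h)) ⟩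
    seq y k ℚ.- η
      ≤⟨ p-q≤r {seq y k} {η} {seq y n} (ℚ.≤-trans (dist-elim {seq y k} {seq y n} (g k n N≤k (ℕ.≤-trans N≤k k≤n))) (ℚ.≤-reflexive (ℚ.+-comm (seq y n) η))) ⟩
    seq y n
      ≤⟨ p≤p+ε (seq y n) 0<δ ⟩
    seq y n ℚ.+ δ ∎)

+-mono-≤ : ∀ {x y u v} → x ≤ y → u ≤ v → x + u ≤ y + v
+-mono-≤ {x} {y} {u} {v} h k ε 0<ε with h (½ ℚ.* ε) (½-pos 0<ε) | k (½ ℚ.* ε) (½-pos 0<ε)
... | M , f | N , g = M ℕ.⊔ N , λ n l → begin
  seq (x + u) n ≡⟨ seq-+ x u n ⟩
  seq x n ℚ.+ seq u n
    ≤⟨ ℚ.+-mono-≤ (f n (ℕ.m⊔n≤o⇒m≤o M N l)) (g n (ℕ.m⊔n≤o⇒n≤o M N l)) ⟩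
  seq y n ℚ.+ ½ ℚ.* ε ℚ.+ (seq v n ℚ.+ ½ ℚ.* ε)
    ≡⟨ solve 3 (λ y v e → y :+ e :+ (v :+ e) := y :+ v :+ (e :+ e)) refl (seq y n) (seq v n) (½ ℚ.* ε) ⟩
  seq y n ℚ.+ seq v n ℚ.+ (½ ℚ.* ε ℚ.+ ½ ℚ.* ε)
    ≡⟨ cong₂ ℚ._+_ (sym (seq-+ y v n)) (½+½ ε) ⟩
  seq (y + v) n ℚ.+ ε ∎
  where
  open ℚ.≤-Reasoning
  open +-*-Solver

+-cong : ∀ {x y u v} → x ≈ y → u ≈ v → x + u ≈ y + v
+-cong {x} {y} {u} {v} (h , h′) (k , k′) = +-mono-≤ {x} {y} {u} {v} h k , +-mono-≤ {y} {x} {v} {u} h′ k′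

*-fromℚ-≤ : ∀ {x p q} → 0ℚ ℚ.≤ q → x ≤ fromℚ p → x * fromℚ q ≤ fromℚ (p ℚ.* q)
*-fromℚ-≤ {x} {p} {q} 0≤q x≤p ε 0<ε = proj₁ close , λ n N≤n → begin
  seq (x * fromℚ q) n                ≡⟨ seq-* x (fromℚ q) n ⟩
  seq x n ℚ.* seq (fromℚ q) n        ≡⟨ cong (seq x n ℚ.*_) (seq-fromℚ q n) ⟩
  seq x n ℚ.* q                      ≤⟨ ℚ.*-monoʳ-≤-nonNeg q {{ℚ.nonNegative 0≤q}} (proj₂ close n N≤n) ⟩
  (seq (fromℚ p) n ℚ.+ ε ℚ.* r) ℚ.* q
    ≡⟨ cong (λ u → (u ℚ.+ ε ℚ.* r) ℚ.* q) (seq-fromℚ p n) ⟩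
  (p ℚ.+ ε ℚ.* r) ℚ.* q
    ≡⟨ solve 4 (λ p e r q → (p :+ e :* r) :* q := p :* q :+ e :* (r :* q)) refl p ε r q ⟩
  p ℚ.* q ℚ.+ ε ℚ.* (r ℚ.* q)
    ≤⟨ ℚ.+-monoʳ-≤ (p ℚ.* q) (ℚ.*-monoˡ-≤-nonNeg ε {{ℚ.nonNegative (ℚ.<⇒≤ 0<ε)}} rq≤1) ⟩
  p ℚ.* q ℚ.+ ε ℚ.* 1ℚ
    ≡⟨ cong₂ ℚ._+_ (sym (seq-fromℚ (p ℚ.* q) n)) (ℚ.*-identityʳ ε) ⟩
  seq (fromℚ (p ℚ.* q)) n ℚ.+ ε ∎
  where
  open ℚ.≤-Reasoning
  open +-*-Solver
  0<1+q : 0ℚ ℚ.< 1ℚ ℚ.+ q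
  0<1+q = ℚ.+-mono-<-≤ (ℚ.positive⁻¹ 1ℚ) 0≤q
  -- Dividing the error by `1 + q` rather than by `q` also covers `q = 0`.
  r = 1/ 1ℚ ℚ.+ q ⟨ 0<1+q ⟩
  close = x≤p (ε ℚ.* r) (*-pos 0<ε (1/-pos _ 0<1+q))
  rq≤1 : r ℚ.* q ℚ.≤ 1ℚ
  rq≤1 = ℚ.≤-trans (ℚ.*-monoˡ-≤-nonNeg r {{ℚ.nonNegative (ℚ.<⇒≤ (1/-pos _ 0<1+q))}}
    (ℚ.≤-trans (p≤p+ε q (ℚ.positive⁻¹ 1ℚ)) (ℚ.≤-reflexive (ℚ.+-comm q 1ℚ))))
    (ℚ.≤-reflexive (1/-inv _ 0<1+q))

*-monoʳ-≤ : ∀ {p x y} → 0ℚ ℚ.≤ p → (∀ n → seq x n ℚ.≤ seq y n) → fromℚ p * x ≤ fromℚ p * y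
*-monoʳ-≤ {p} {x} {y} 0≤p x≤y = seq-≤⇒≤ {fromℚ p * x} {fromℚ p * y} λ n → subst₂ ℚ._≤_
  (sym (trans (seq-* (fromℚ p) x n) (cong (ℚ._* seq x n) (seq-fromℚ p n))))
  (sym (trans (seq-* (fromℚ p) y n) (cong (ℚ._* seq y n) (seq-fromℚ p n))))
  (ℚ.*-monoˡ-≤-nonNeg p {{ℚ.nonNegative 0≤p}} (x≤y n))

-- Natural numbers as reals

//1-mono : ∀ {m n} → m ℕ.≤ n → (m // 1) ℚ.≤ (n // 1)
//1-mono {m} {n} h = //-mono {m} {n} 0 0 (ℕ.*-monoˡ-≤ 1 h)

//1-+ : ∀ m n → (m ℕ.+ n) // 1 ≡ (m // 1) ℚ.+ (n // 1)
//1-+ m n = sym (trans (//-+ m n 0 0) (cong (_// 1) (cong₂ ℕ._+_ (ℕ.*-identityʳ m) (ℕ.*-identityʳ n))))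

//1-* : ∀ m n → (m ℕ.* n) // 1 ≡ (m // 1) ℚ.* (n // 1)
//1-* m n = sym (//-* m n 0 0)

fromℕ-mono : ∀ {m n} → m ℕ.≤ n → fromℕ m ≤ fromℕ n
fromℕ-mono {m} {n} h = seq-≤⇒≤ {fromℕ m} {fromℕ n} λ k →
  subst₂ ℚ._≤_ (sym (seq-fromℚ _ k)) (sym (seq-fromℚ _ k)) (//1-mono h)

-- Distinct naturals differ by at least 1, so the inequality at a single index with tolerance ½ is
-- enough.
fromℕ-cancel : ∀ {m n} → fromℕ m ≤ fromℕ n → m ℕ.≤ n
fromℕ-cancel {m} {n} h with h ½ (ℚ.positive⁻¹ ½)
... | N , f = ℕ.≮⇒≥ λ n<m → ℕ.1+n≰n (ℕ.+-cancelˡ-≤ (2 ℕ.* n) 2 1 (ℕ.≤-trans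
    (ℕ.≤-reflexive (lhs n)) (ℕ.≤-trans (//-mono⁻¹ {suc n} {n ℕ.* 2 ℕ.+ 1 ℕ.* 1} 0 1 (begin
      suc n // 1                     ≤⟨ //1-mono n<m ⟩
      m // 1                         ≡⟨ seq-fromℚ _ N ⟨
      seq (fromℕ m) N                ≤⟨ f N ℕ.≤-refl ⟩
      seq (fromℕ n) N ℚ.+ (1 // 2)   ≡⟨ cong (ℚ._+ (1 // 2)) (seq-fromℚ _ N) ⟩
      (n // 1) ℚ.+ (1 // 2)          ≡⟨ //-+ n 1 0 1 ⟩
      (n ℕ.* 2 ℕ.+ 1 ℕ.* 1) // 2     ∎)) (ℕ.≤-reflexive (rhs n)))))
  where
  open ℚ.≤-Reasoning
  lhs : ∀ n → 2 ℕ.* n ℕ.+ 2 ≡ suc n ℕ.* 2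
  lhs = solve-∀
  rhs : ∀ n → (n ℕ.* 2 ℕ.+ 1 ℕ.* 1) ℕ.* 1 ≡ 2 ℕ.* n ℕ.+ 1
  rhs = solve-∀

fromℕ-+ : ∀ m n → fromℕ (m ℕ.+ n) ≈ fromℕ m + fromℕ n
fromℕ-+ m n = seq-≡⇒≈ {fromℕ (m ℕ.+ n)} {fromℕ m + fromℕ n} λ k → trans (seq-fromℚ _ k)
  (trans (//1-+ m n) (trans (cong₂ ℚ._+_ (sym (seq-fromℚ _ k)) (sym (seq-fromℚ _ k)))
    (sym (seq-+ (fromℕ m) (fromℕ n) k))))

fromℕ-∣-∣ : ∀ m n → fromℕ ℕ.∣ m - n ∣ ≈ ∣ fromℕ m - fromℕ n ∣
fromℕ-∣-∣ m n = seq-≡⇒≈ {fromℕ ℕ.∣ m - n ∣} {∣ fromℕ m - fromℕ n ∣} λ k → trans (seq-fromℚ _ k) (sym (trans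
  (seq-∣∣ (fromℕ m - fromℕ n) k) (trans (cong ℚ.∣_∣ (trans (seq-+ (fromℕ m) (- fromℕ n) k)
    (cong₂ ℚ._+_ (seq-fromℚ _ k) (trans (seq-neg (fromℕ n) k) (cong ℚ.-_ (seq-fromℚ _ k)))))) (go m n))))
  where
  cancel : ∀ a b → (a // 1) ℚ.+ (b // 1) ℚ.- (a // 1) ≡ b // 1
  cancel a b = solve 2 (λ a b → a :+ b :- a := b) refl (a // 1) (b // 1)
    where open +-*-Solver
  below : ∀ m k → ℚ.∣ ((m ℕ.+ k) // 1) ℚ.- (m // 1) ∣ ≡ k // 1
  below m k = trans (cong (λ u → ℚ.∣ u ℚ.- (m // 1) ∣) (//1-+ m k))
    (trans (cong ℚ.∣_∣ (cancel m k)) (ℚ.0≤p⇒∣p∣≡p (//1-mono {0} {k} z≤n)))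
  ordered : ∀ m n → m ℕ.≤ n → ℚ.∣ (n // 1) ℚ.- (m // 1) ∣ ≡ ℕ.∣ n - m ∣ // 1
  ordered m n m≤n with k , refl ← ℕ.m≤n⇒∃[o]m+o≡n m≤n = trans (below m k)
    (cong (_// 1) (sym (trans (ℕ.∣-∣-comm (m ℕ.+ k) m) (ℕ.∣m-m+n∣≡n m k))))
  go : ∀ m n → ℚ.∣ (m // 1) ℚ.- (n // 1) ∣ ≡ ℕ.∣ m - n ∣ // 1
  go m n with ℕ.≤-total n m
  ... | inj₁ n≤m = ordered n m n≤m
  ... | inj₂ m≤n = trans (dist-sym (m // 1) (n // 1)) (trans (ordered m n m≤n) (cong (_// 1) (ℕ.∣-∣-comm n m)))

≤-//1 : ∀ q → 0ℚ ℚ.≤ q → q ℚ.≤ (ℤ.∣ ℚ.↥ q ∣ // 1)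
≤-//1 q 0≤q = ℚ.≤-trans (ℚ.≤-reflexive (sym (∣↥∣//↧ q 0≤q)))
  (//-mono {ℤ.∣ ℚ.↥ q ∣} {ℤ.∣ ℚ.↥ q ∣} (ℚ.denominator-1 q) 0 (ℕ.*-monoʳ-≤ ℤ.∣ ℚ.↥ q ∣ (s≤s z≤n)))

≤-fromℚ⇒≤-fromℕ : ∀ {x q n} → x ≤ fromℚ q → q ℚ.≤ (n // 1) → x ≤ fromℕ n
≤-fromℚ⇒≤-fromℕ {x} {q} {n} h q≤n = ≤-trans {x} {fromℚ q} {fromℕ n} h
  (seq-≤⇒≤ {fromℚ q} {fromℕ n} λ k → subst₂ ℚ._≤_ (sym (seq-fromℚ _ k)) (sym (seq-fromℚ _ k)) q≤n)

≤-fromℚ : ∀ x → ∃[ q ] 0ℚ ℚ.< q × x ≤ fromℚ q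
≤-fromℚ x = B , proj₁ (proj₂ bounded) , λ ε 0<ε → proj₁ (proj₂ (proj₂ bounded)) , λ k N≤k →
  ℚ.≤-trans (p≤∣p∣ (seq x k)) (ℚ.≤-trans (proj₂ (proj₂ (proj₂ bounded)) k N≤k)
    (ℚ.≤-trans (ℚ.≤-reflexive (sym (seq-fromℚ B k))) (p≤p+ε (seq (fromℚ B) k) 0<ε)))
  where
  bounded = eventually-bounded x
  B = proj₁ bounded

-- Serves to replace the additive constant of competitiveness by a natural number.
≤-fromℕ : ∀ x → ∃[ n ] x ≤ fromℕ n
≤-fromℕ x = let B , 0<B , x≤B = ≤-fromℚ x in
  ℤ.∣ ℚ.↥ B ∣ , ≤-fromℚ⇒≤-fromℕ {x} {B} {ℤ.∣ ℚ.↥ B ∣} x≤B (≤-//1 B (ℚ.<⇒≤ 0<B))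

-- Upper bounds on roots, logarithms and quotients

√-≤ : ∀ {s h} → s ℕ.≤ h ℕ.* h → ∀ k → seq (√ s) k ℚ.≤ (h // 1)
√-≤ {s} {h} s≤h² k = ℚ.≤-trans (ℚ.≤-reflexive (seq-√ s k))
  (//-mono {r} {h} k 0 (ℕ.≤-trans (ℕ.≤-reflexive (ℕ.*-identityʳ r))
    (ℕ.≮⇒≥ λ hk<r → ℕ.<⇒≱ (ℕ.*-mono-< hk<r hk<r) (begin
      r ℕ.* r                            ≤⟨ isqrt-lower (s ℕ.* (suc k ℕ.* suc k)) ⟩
      s ℕ.* (suc k ℕ.* suc k)            ≤⟨ ℕ.*-monoˡ-≤ (suc k ℕ.* suc k) s≤h² ⟩
      h ℕ.* h ℕ.* (suc k ℕ.* suc k)      ≡⟨ interchange h (suc k) ⟩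
      h ℕ.* suc k ℕ.* (h ℕ.* suc k)      ∎))))
  where
  open ℕ.≤-Reasoning
  r = isqrt (s ℕ.* (suc k ℕ.* suc k))
  interchange : ∀ h k → h ℕ.* h ℕ.* (k ℕ.* k) ≡ h ℕ.* k ℕ.* (h ℕ.* k)
  interchange = solve-∀

⌊q^k⌋≤n^k : ∀ n q k → 0ℚ ℚ.≤ q → q ℚ.≤ (n // 1) → ⌊ q ^ k ⌋ ℕ.≤ n ℕ.^ k
⌊q^k⌋≤n^k n q k 0≤q q≤n = ℕ.*-cancelʳ-≤ _ _ (ℚ.↧ₙ q ℕ.^ k) {{ℕ.m^n≢0 (ℚ.↧ₙ q) k}} (begin
  ⌊ q ^ k ⌋ ℕ.* ℚ.↧ₙ q ℕ.^ k    ≤⟨ ⌊^⌋-lower q k ⟩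
  ℤ.∣ ℚ.↥ q ∣ ℕ.^ k             ≤⟨ ℕ.^-monoˡ-≤ k (ℕ.≤-trans (ℕ.≤-reflexive (sym (ℕ.*-identityʳ _)))
                                     (//-mono⁻¹ {ℤ.∣ ℚ.↥ q ∣} {n} (ℚ.denominator-1 q) 0
                                       (ℚ.≤-trans (ℚ.≤-reflexive (∣↥∣//↧ q 0≤q)) q≤n))) ⟩
  (n ℕ.* ℚ.↧ₙ q) ℕ.^ k          ≡⟨ [mn]^k n (ℚ.↧ₙ q) k ⟩
  n ℕ.^ k ℕ.* ℚ.↧ₙ q ℕ.^ k      ∎)
  where open ℕ.≤-Reasoning

-- The truncation of the terms at 1 inside `log₂` does no harm, because `2 ^ e` is at least 1.
log₂-≤ : ∀ x e → (∀ k → seq x k ℚ.≤ ((2 ℕ.^ e) // 1)) → ∀ k → seq (log₂ x) k ℚ.≤ (e // 1)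
log₂-≤ x e x≤2^e k = ℚ.≤-trans (ℚ.≤-reflexive (seq-log₂ x k))
  (//-mono {log₂-term (seq x) k} {e} k 0 (begin
    log₂-term (seq x) k ℕ.* 1              ≡⟨ ℕ.*-identityʳ _ ⟩
    log₂-term (seq x) k                    ≤⟨ ⌊log₂⌋-mono-≤ (⌊q^k⌋≤n^k (2 ℕ.^ e) _ (suc k)
      (ℚ.≤-trans (ℚ.nonNegative⁻¹ 1ℚ) (ℚ.p≤q⊔p (seq x k) 1ℚ))
      (ℚ.⊔-lub (x≤2^e k) (//1-mono (ℕ.m^n>0 2 e)))) ⟩
    ⌊log₂ (2 ℕ.^ e) ℕ.^ suc k ⌋            ≡⟨ cong ⌊log₂_⌋ (ℕ.^-*-assoc 2 e (suc k)) ⟩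
    ⌊log₂ 2 ℕ.^ (e ℕ.* suc k) ⌋            ≡⟨ ⌊log₂[2^n]⌋≡n (e ℕ.* suc k) ⟩
    e ℕ.* suc k                            ∎))
  where open ℕ.≤-Reasoning

-- Each term `R` of the reciprocal satisfies `R * z ≡ 1` for some `z` that is at least the term of
-- `y`, hence at least `q`. Replacing `q` by `z` in `r * q * R` therefore leaves `r`.
÷-≤ : ∀ {x y p q r} (0<y : 0ℝ < y) → 0ℚ ℚ.≤ r → (∀ k → seq x k ℚ.≤ p) → (∀ k → q ℚ.≤ seq y k) →
      p ℚ.≤ r ℚ.* q → ∀ k → seq (x ÷ y [ 0<y ]) k ℚ.≤ r
÷-≤ {x} {y} {p} {q} {r} 0<y 0≤r x≤p q≤y p≤rq k = begin
  seq (x ÷ y [ 0<y ]) k    ≡⟨ seq-* x (recip y 0<y) k ⟩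
  seq x k ℚ.* R            ≤⟨ ℚ.*-monoʳ-≤-nonNeg R (ℚ.≤-trans (x≤p k) p≤rq) ⟩
  r ℚ.* q ℚ.* R            ≤⟨ ℚ.*-monoʳ-≤-nonNeg R (ℚ.*-monoˡ-≤-nonNeg r {{ℚ.nonNegative 0≤r}}
                                (ℚ.≤-trans (q≤y k) (ℚ.p≤p⊔q (seq y k) (proj₁ 0<y)))) ⟩
  r ℚ.* z ℚ.* R            ≡⟨ solve 3 (λ r z R → r :* z :* R := r :* (R :* z)) refl r z R ⟩
  r ℚ.* (R ℚ.* z)          ≡⟨ cong (r ℚ.*_) (seq-recip y 0<y k) ⟩
  r ℚ.* 1ℚ                 ≡⟨ ℚ.*-identityʳ r ⟩
  r                        ∎
  where
  open ℚ.≤-Reasoning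
  open +-*-Solver
  R = seq (recip y 0<y) k
  z = seq y k ℚ.⊔ proj₁ 0<y
  0≤z : 0ℚ ℚ.≤ z
  0≤z = ℚ.≤-trans (ℚ.<⇒≤ (proj₁ (proj₂ 0<y))) (ℚ.p≤q⊔p (seq y k) (proj₁ 0<y))
  0≤R : 0ℚ ℚ.≤ R
  0≤R with ℚ.≤-total 0ℚ R
  ... | inj₁ h = h
  ... | inj₂ R≤0 = ⊥-elim (ℚ.<-irrefl refl (ℚ.<-≤-trans (ℚ.positive⁻¹ 1ℚ) 1≤0))
    where
    1≤0 : 1ℚ ℚ.≤ 0ℚ
    1≤0 = begin
      1ℚ          ≡⟨ seq-recip y 0<y k ⟨
      R ℚ.* z     ≤⟨ ℚ.*-monoʳ-≤-nonNeg z {{ℚ.nonNegative 0≤z}} R≤0 ⟩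
      0ℚ ℚ.* z    ≡⟨ ℚ.*-zeroˡ z ⟩
      0ℚ          ∎
  instance
    R-nonNeg : ℚ.NonNegative R
    R-nonNeg = ℚ.nonNegative 0≤R

-- Choice of the depth and the base

n<2^n : ∀ n → n ℕ.< 2 ℕ.^ n
n<2^n zero    = s≤s z≤n
n<2^n (suc n) = ℕ.+-mono-≤ (ℕ.m^n>0 2 n) (ℕ.≤-trans (n<2^n n) (ℕ.m≤m+n _ 0))

-- Applied to `λ′`, this makes `log₂ n` large enough compared with the square of `log₂ log₂ n` for
-- the depth to reach `s`.
n[1+n]≤2^[1+n] : ∀ n → n ℕ.* suc n ℕ.≤ 2 ℕ.^ suc n
n[1+n]≤2^[1+n] zero    = z≤n
n[1+n]≤2^[1+n] (suc n) = begin
  suc n ℕ.* suc (suc n)                    ≡⟨ expand n ⟩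
  n ℕ.* suc n ℕ.+ 2 ℕ.* suc n              ≤⟨ ℕ.+-mono-≤ (n[1+n]≤2^[1+n] n) (ℕ.*-monoʳ-≤ 2 (n<2^n n)) ⟩
  2 ℕ.^ suc n ℕ.+ 2 ℕ.^ suc n              ≡⟨ cong (2 ℕ.^ suc n ℕ.+_) (ℕ.+-identityʳ _) ⟨
  2 ℕ.^ suc (suc n)                        ∎
  where
  open ℕ.≤-Reasoning
  expand : ∀ n → suc n ℕ.* suc (suc n) ≡ n ℕ.* suc n ℕ.+ 2 ℕ.* suc n
  expand = solve-∀

-- Beyond this point `log₂ log₂ n` is at least `2 * s`, which forces `s ≤ depth`, so that the depth
-- also dominates `√ s`.
threshold : ℕ → ℕ
threshold s = 2 ℕ.^ 2 ℕ.^ (2 ℕ.* s)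

module Parameters (s : ℕ) .{{_ : NonZero s}} (n : ℕ) (threshold≤n : threshold s ℕ.≤ n) where

  -- `base` is a power of two just above `ℓ`, hence above `depth`. Dividing `ℓ` by the exponent of
  -- `base` keeps `base ^ depth` at most `2 ^ ℓ`.
  ℓ λ′ depth base : ℕ
  ℓ     = ⌊log₂ n ⌋
  λ′    = ⌊log₂ ℓ ⌋
  depth = ℓ ℕ./ suc λ′
  base  = 2 ℕ.^ suc λ′

  private
    2^2s≤ℓ : 2 ℕ.^ (2 ℕ.* s) ℕ.≤ ℓ
    2^2s≤ℓ = ℕ.≤-trans (ℕ.≤-reflexive (sym (⌊log₂[2^n]⌋≡n (2 ℕ.^ (2 ℕ.* s))))) (⌊log₂⌋-mono-≤ threshold≤n)

    2s≤λ : 2 ℕ.* s ℕ.≤ λ′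
    2s≤λ = ℕ.≤-trans (ℕ.≤-reflexive (sym (⌊log₂[2^n]⌋≡n (2 ℕ.* s)))) (⌊log₂⌋-mono-≤ 2^2s≤ℓ)

    2^ℓ≤n : 2 ℕ.^ ℓ ℕ.≤ n
    2^ℓ≤n = 2^⌊log₂n⌋≤n n {{ℕ.>-nonZero (ℕ.≤-trans (ℕ.m^n>0 2 (2 ℕ.^ (2 ℕ.* s))) threshold≤n)}}

    2^λ≤ℓ : 2 ℕ.^ λ′ ℕ.≤ ℓ
    2^λ≤ℓ = 2^⌊log₂n⌋≤n ℓ {{ℕ.>-nonZero (ℕ.≤-trans (ℕ.m^n>0 2 (2 ℕ.* s)) 2^2s≤ℓ)}}

    2≤λ : 2 ℕ.≤ λ′
    2≤λ = ℕ.≤-trans (ℕ.*-monoʳ-≤ 2 (ℕ.>-nonZero⁻¹ s)) 2s≤λ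

  -- It suffices that `s * suc λ′` is at most `ℓ`. After doubling, this follows from `2 * s ≤ λ′`
  -- and `λ′ * suc λ′ ≤ 2 * 2 ^ λ′`.
  s≤depth : s ℕ.≤ depth
  s≤depth = begin
    s                                ≡⟨ ℕ.m*n/n≡m s (suc λ′) ⟨
    s ℕ.* suc λ′ ℕ./ suc λ′          ≤⟨ ℕ./-monoˡ-≤ {s ℕ.* suc λ′} {ℓ} (suc λ′) (ℕ.*-cancelˡ-≤ 2 (begin
      2 ℕ.* (s ℕ.* suc λ′)             ≡⟨ ℕ.*-assoc 2 s (suc λ′) ⟨
      2 ℕ.* s ℕ.* suc λ′               ≤⟨ ℕ.*-monoˡ-≤ (suc λ′) 2s≤λ ⟩
      λ′ ℕ.* suc λ′                    ≤⟨ n[1+n]≤2^[1+n] λ′ ⟩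
      2 ℕ.* 2 ℕ.^ λ′                   ≤⟨ ℕ.*-monoʳ-≤ 2 2^λ≤ℓ ⟩
      2 ℕ.* ℓ                          ∎)) ⟩
    depth                            ∎
    where open ℕ.≤-Reasoning

  0<depth : 0 ℕ.< depth
  0<depth = ℕ.≤-trans (ℕ.>-nonZero⁻¹ s) s≤depth

  3≤base : 3 ℕ.≤ base
  3≤base = ℕ.≤-trans (s≤s (s≤s (s≤s z≤n))) (ℕ.^-monoʳ-≤ 2 (s≤s 2≤λ))

  depth≤base : depth ℕ.≤ base
  depth≤base = ℕ.≤-trans (ℕ.m/n≤m ℓ (suc λ′)) (ℕ.<⇒≤ (n<2^[1+⌊log₂n⌋] ℓ))

  base^depth≤n : base ℕ.^ depth ℕ.≤ n
  base^depth≤n = begin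
    base ℕ.^ depth                 ≡⟨ ℕ.^-*-assoc 2 (suc λ′) depth ⟩
    2 ℕ.^ (suc λ′ ℕ.* depth)       ≤⟨ ℕ.^-monoʳ-≤ 2 (ℕ.≤-trans (ℕ.≤-reflexive (ℕ.*-comm (suc λ′) depth)) (ℕ.m/n*n≤m ℓ (suc λ′))) ⟩
    2 ℕ.^ ℓ                        ≤⟨ 2^ℓ≤n ⟩
    n                              ∎
    where open ℕ.≤-Reasoning

  -- Division with remainder gives `suc ℓ ≤ suc depth * suc λ′`, and each successor at most doubles
  -- a positive number. The left side is `suc ℓ` because `log₂ n` may exceed its floor `ℓ`.
  1+ℓ≤4*depth*λ : suc ℓ ℕ.≤ 4 ℕ.* depth ℕ.* λ′
  1+ℓ≤4*depth*λ = begin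
    suc ℓ                                            ≡⟨ cong suc (ℕ.m≡m%n+[m/n]*n ℓ (suc λ′)) ⟩
    suc (ℓ ℕ.% suc λ′) ℕ.+ depth ℕ.* suc λ′          ≤⟨ ℕ.+-monoˡ-≤ (depth ℕ.* suc λ′) (ℕ.m%n<n ℓ (suc λ′)) ⟩
    suc depth ℕ.* suc λ′                             ≤⟨ ℕ.*-mono-≤ (ℕ.+-monoˡ-≤ depth 0<depth)
                                                          (ℕ.+-monoˡ-≤ λ′ (ℕ.≤-trans (s≤s z≤n) 2≤λ)) ⟩
    (depth ℕ.+ depth) ℕ.* (λ′ ℕ.+ λ′)                ≡⟨ collect depth λ′ ⟩
    4 ℕ.* depth ℕ.* λ′                               ∎
    where
    open ℕ.≤-Reasoning
    collect : ∀ d l → (d ℕ.+ d) ℕ.* (l ℕ.+ l) ≡ 4 ℕ.* d ℕ.* l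
    collect = solve-∀

  -- The root contributes at most `depth`, since `s ≤ depth ≤ depth²`. The quotient of logarithms is
  -- at most `suc ℓ` over `λ′`, hence at most `4 * depth`.
  bound≤5*depth : ∀ (4≤n : 4 ℕ.≤ n) k →
    seq (√ s + log₂ (fromℕ n) ÷ log₂ (log₂ (fromℕ n)) [ 0<log₂log₂ 4≤n ]) k ℚ.≤ seq (fromℕ (5 ℕ.* depth)) k
  bound≤5*depth 4≤n k = begin
    seq (√ s + L) k                          ≡⟨ seq-+ (√ s) L k ⟩
    seq (√ s) k ℚ.+ seq L k                  ≤⟨ ℚ.+-mono-≤ (√-≤ {s} {depth} s≤depth² k) (L≤4*depth k) ⟩
    (depth // 1) ℚ.+ ((4 ℕ.* depth) // 1)    ≡⟨ //1-+ depth (4 ℕ.* depth) ⟨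
    (5 ℕ.* depth) // 1                       ≡⟨ seq-fromℚ _ k ⟨
    seq (fromℕ (5 ℕ.* depth)) k              ∎
    where
    open ℚ.≤-Reasoning
    L = log₂ (fromℕ n) ÷ log₂ (log₂ (fromℕ n)) [ 0<log₂log₂ 4≤n ]
    s≤depth² : s ℕ.≤ depth ℕ.* depth
    s≤depth² = ℕ.≤-trans s≤depth (ℕ.≤-trans (ℕ.≤-reflexive (sym (ℕ.*-identityʳ depth))) (ℕ.*-monoʳ-≤ depth 0<depth))
    log₂n≤1+ℓ : ∀ k → seq (log₂ (fromℕ n)) k ℚ.≤ (suc ℓ // 1)
    log₂n≤1+ℓ = log₂-≤ (fromℕ n) (suc ℓ) λ k →
      ℚ.≤-trans (ℚ.≤-reflexive (seq-fromℚ _ k)) (//1-mono (ℕ.<⇒≤ (n<2^[1+⌊log₂n⌋] n)))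
    ℓ≤log₂n : ∀ k → (ℓ // 1) ℚ.≤ seq (log₂ (fromℕ n)) k
    ℓ≤log₂n = log₂-≥ (fromℕ n) ℓ λ k →
      ℚ.≤-trans (//1-mono 2^ℓ≤n) (ℚ.≤-reflexive (sym (seq-fromℚ _ k)))
    λ≤log₂log₂n : ∀ k → (λ′ // 1) ℚ.≤ seq (log₂ (log₂ (fromℕ n))) k
    λ≤log₂log₂n = log₂-≥ (log₂ (fromℕ n)) λ′ λ k → ℚ.≤-trans (//1-mono 2^λ≤ℓ) (ℓ≤log₂n k)
    L≤4*depth : ∀ k → seq L k ℚ.≤ ((4 ℕ.* depth) // 1)
    L≤4*depth = ÷-≤ {log₂ (fromℕ n)} {log₂ (log₂ (fromℕ n))} {suc ℓ // 1} {λ′ // 1} (0<log₂log₂ 4≤n)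
      (//1-mono {0} {4 ℕ.* depth} z≤n) log₂n≤1+ℓ λ≤log₂log₂n
      (ℚ.≤-trans (//1-mono {suc ℓ} {4 ℕ.* depth ℕ.* λ′} 1+ℓ≤4*depth*λ) (ℚ.≤-reflexive (//1-* (4 ℕ.* depth) λ′)))

-- Instances on the integer line

1//-anti : ∀ {m n} .{{_ : NonZero m}} .{{_ : NonZero n}} → m ℕ.≤ n → (1 // n) ℚ.≤ (1 // m)
1//-anti {suc m} {suc n} m≤n = //-mono {1} {1} n m (ℕ.*-monoʳ-≤ 1 m≤n)

≈-refl : ∀ x → x ≈ x
≈-refl x = IsEquivalence.refl ≈-isEquivalence {x}

fromℕ-cong : ∀ {m n} → m ≡ n → fromℕ m ≈ fromℕ n
fromℕ-cong {m} refl = ≈-refl (fromℕ m)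

≈-sym : ∀ {x y} → x ≈ y → y ≈ x
≈-sym (p , q) = q , p

≈-trans : ∀ {x y z} → x ≈ y → y ≈ z → x ≈ z
≈-trans {x} {y} {z} = IsEquivalence.trans ≈-isEquivalence {x} {y} {z}

-- A record rather than an abbreviation, so that Agda can infer x and n.
infix 4 _≗ℕ_

record _≗ℕ_ (x : ℝ) (n : ℕ) : Set where
  constructor natural
  field
    ≈fromℕ : x ≈ fromℕ n

open _≗ℕ_

fromℕ-≗ℕ : ∀ {n} → fromℕ n ≗ℕ n
fromℕ-≗ℕ {n} = natural (≈-refl (fromℕ n))

+-≗ℕ : ∀ {x y m n} → x ≗ℕ m → y ≗ℕ n → x + y ≗ℕ m ℕ.+ n
+-≗ℕ {x} {y} {m} {n} (natural p) (natural q) = natural (≈-trans {x + y} {fromℕ m + fromℕ n} {fromℕ (m ℕ.+ n)}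
  (+-cong {x} {fromℕ m} {y} {fromℕ n} p q) (≈-sym {fromℕ (m ℕ.+ n)} {fromℕ m + fromℕ n} (fromℕ-+ m n)))

∑ℕ : ∀ {n} → (Fin n → ℕ) → ℕ
∑ℕ = Vector.foldr ℕ._+_ 0

∑-≗ℕ : ∀ {n} {g : Fin n → ℝ} {g′ : Fin n → ℕ} → (∀ i → g i ≗ℕ g′ i) → ∑ g ≗ℕ ∑ℕ g′
∑-≗ℕ {zero}  h = fromℕ-≗ℕ
∑-≗ℕ {suc n} h = +-≗ℕ (h Fin.zero) (∑-≗ℕ (λ i → h (Fin.suc i)))

term≤∑ℕ : ∀ {n} (g : Fin n → ℕ) i → g i ℕ.≤ ∑ℕ g
term≤∑ℕ g Fin.zero    = ℕ.m≤m+n _ _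
term≤∑ℕ g (Fin.suc i) = ℕ.≤-trans (term≤∑ℕ (λ j → g (Fin.suc j)) i) (ℕ.m≤n+m _ _)

∑ℕ-lookup : ∀ {A : Set} (g : A → ℕ) (xs : List A) → ∑ℕ (λ j → g (lookup xs j)) ≡ sum (map g xs)
∑ℕ-lookup g []       = refl
∑ℕ-lookup g (x ∷ xs) = cong (g x ℕ.+_) (∑ℕ-lookup g xs)

-- As `P` need not be decidable, the least element is found only up to double negation: if there
-- were none, strong induction would refute `P m` for every `m ≤ n`.
¬¬-least : (P : ℕ → Set) → ∀ n → P n → ¬ ¬ (∃[ m ] m ℕ.≤ n × P m × (∀ k → P k → m ℕ.≤ k))
¬¬-least P n p none = n-minimal n ℕ.≤-refl p
  where
  n-minimal : ∀ m → m ℕ.≤ n → ¬ P m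
  n-minimal m m≤n q = below (suc m) m ℕ.≤-refl m≤n q
    where
    below : ∀ b m → m ℕ.< b → m ℕ.≤ n → ¬ P m
    below (suc b) m (s≤s m≤b) m≤n q = none (m , m≤n , q , λ k r →
      ℕ.≮⇒≥ λ k<m → below b k (ℕ.<-≤-trans k<m m≤b) (ℕ.≤-trans (ℕ.<⇒≤ k<m) m≤n) r)

-- The points 0, ..., `P` of the integer line with distances scaled by `K`; the scale lets the costs
-- outgrow any additive constant. Integer data make every cost a natural number, and a facility cost
-- independent of the configuration meets both cost assumptions.
module Line (s : ℕ) .{{_ : NonZero s}} (K : ℕ) .{{_ : NonZero K}} (F P : ℕ) where
  open OMFLP s

  dist : Fin (suc P) → Fin (suc P) → ℕ
  dist i j = K ℕ.* ℕ.∣ toℕ i - toℕ j ∣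

  line : Environment
  line = record
    { points = suc P
    ; d = λ i j → fromℕ (dist i j)
    ; isMetric = record
      { isSemiMetric = record
        { isQuasiSemiMetric = record
          { isPreMetric = record
            { isProtoMetric = record
              { isPartialOrder  = ≤-isPartialOrder
              ; ≈-isEquivalence = isEquivalence
              ; cong            = λ { {i} {_} {j} refl refl → ≈-refl (fromℕ (dist i j)) }
              ; nonNegative     = λ {i} {j} → fromℕ-mono {0} {dist i j} z≤n
              }
            ; ≈⇒0 = λ { {i} refl → fromℕ-cong {dist i i} {0} (trans (cong (K ℕ.*_) (ℕ.∣n-n∣≡0 (toℕ i))) (ℕ.*-zeroʳ K)) }
            }
          ; 0⇒≈ = λ {i} {j} (d≤0 , _) → Fin.toℕ-injective (ℕ.∣m-n∣≡0⇒m≡n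
              (ℕ.m*n≡0⇒m≡0 _ K (trans (ℕ.*-comm _ K) (ℕ.n≤0⇒n≡0 (fromℕ-cancel {dist i j} {0} d≤0)))))
          }
        ; sym = λ i j → fromℕ-cong {dist i j} {dist j i} (cong (K ℕ.*_) (ℕ.∣-∣-comm (toℕ i) (toℕ j)))
        }
      ; triangle = λ i j k → ≤-trans {fromℕ (dist i k)} {fromℕ (dist i j ℕ.+ dist j k)} {fromℕ (dist i j) + fromℕ (dist j k)}
          (fromℕ-mono {dist i k} {dist i j ℕ.+ dist j k} (ℕ.≤-trans (ℕ.*-monoʳ-≤ K (ℕ.∣-∣-triangle (toℕ i) (toℕ j) (toℕ k)))
            (ℕ.≤-reflexive (ℕ.*-distribˡ-+ K _ _))))
          (proj₁ (fromℕ-+ (dist i j) (dist j k)))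
      }
    ; f = λ _ _ → fromℕ F
    ; nonNegative = λ _ _ → fromℕ-mono {0} {F} z≤n
    ; subadditive = λ _ _ _ → ≤-trans {fromℕ F} {fromℕ (F ℕ.+ F)} {fromℕ F + fromℕ F}
        (fromℕ-mono {F} {F ℕ.+ F} (ℕ.m≤m+n F F)) (proj₁ (fromℕ-+ F F))
    ; average = λ _ σ → *-monoʳ-≤ {F // 1} {fromℚ (1 // s)} {fromℚ (1 // Subset.∣ σ ∣)} (//1-mono {0} {F} z≤n) λ k →
        subst₂ ℚ._≤_ (sym (seq-fromℚ _ k)) (sym (seq-fromℚ _ k)) (1//-anti (Subset.∣p∣≤n σ))
    }

  onLine : OnLine line
  onLine = (λ i → fromℕ (K ℕ.* toℕ i)) , λ i j →
    ≈-trans {fromℕ (dist i j)} {fromℕ ℕ.∣ K ℕ.* toℕ i - K ℕ.* toℕ j ∣} {∣ fromℕ (K ℕ.* toℕ i) - fromℕ (K ℕ.* toℕ j) ∣}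
      (fromℕ-cong {dist i j} (ℕ.*-distribˡ-∣-∣ K (toℕ i) (toℕ j)))
      (fromℕ-∣-∣ (K ℕ.* toℕ i) (K ℕ.* toℕ j))

  open Request

  assignmentℕ : (fs : List (Facility line)) → Subset (length fs) → Request line → ℕ
  assignmentℕ fs A r = ∑ℕ λ i → if Vec.lookup A i then dist (proj₁ (lookup fs i)) (location r) else 0

  constructionCost-≗ℕ : ∀ fs → constructionCost line fs ≗ℕ length fs ℕ.* F
  constructionCost-≗ℕ []       = fromℕ-≗ℕ
  constructionCost-≗ℕ (x ∷ fs) = +-≗ℕ fromℕ-≗ℕ (constructionCost-≗ℕ fs)

  assignmentCost-≗ℕ : ∀ fs A r → assignmentCost line fs A r ≗ℕ assignmentℕ fs A r
  assignmentCost-≗ℕ fs A r = ∑-≗ℕ λ i → if-≗ℕ (Vec.lookup A i)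
    where
    if-≗ℕ : ∀ b {n} → (if b then fromℕ n else 0ℝ) ≗ℕ (if b then n else 0)
    if-≗ℕ false = fromℕ-≗ℕ
    if-≗ℕ true  = fromℕ-≗ℕ

  solutionCost : ∀ {rs} → Solution line rs → ℕ
  solutionCost {rs} S = length facilities ℕ.* F ℕ.+ ∑ℕ λ j → assignmentℕ facilities (assigned j) (lookup rs j)
    where open Solution S

  solutionCost-≗ℕ : ∀ {rs} (S : Solution line rs) → Solution.cost S ≗ℕ solutionCost S
  solutionCost-≗ℕ {rs} S = +-≗ℕ (constructionCost-≗ℕ facilities)
    (∑-≗ℕ λ j → assignmentCost-≗ℕ facilities (assigned j) (lookup rs j))
    where open Solution S

  distances : Fin (suc P) → List (Request line) → ℕ
  distances m rs = sum (map (λ r → dist m (location r)) rs)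

  singleFacility : ∀ m rs → Solution line rs
  singleFacility m rs = record
    { facilities = (m , ⊤) ∷ []
    ; assigned   = λ _ → ⊤
    ; serves     = λ _ _ → Fin.zero , Subset.∈⊤ , Subset.∈⊤
    }

  singleFacility-cost : ∀ m rs → solutionCost (singleFacility m rs) ≡ F ℕ.+ distances m rs
  singleFacility-cost m rs = cong₂ ℕ._+_ (ℕ.+-identityʳ F)
    (trans (∑ℕ-lookup (λ r → dist m (location r) ℕ.+ 0) rs)
      (cong sum (List.map-cong (λ r → ℕ.+-identityʳ (dist m (location r))) rs)))

  -- Costs are natural numbers, so the well-ordering of ℕ yields an attained minimum, as `IsOPT`
  -- demands. The given solution starts the search and bounds its outcome.
  ¬¬-OPT : ∀ rs (S : Solution line rs) → ¬ ¬ (∃[ v ] v ℕ.≤ solutionCost S × IsOPT line rs (fromℕ v))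
  ¬¬-OPT rs S none = ¬¬-least (λ v → ∃[ T ] solutionCost {rs} T ≡ v) (solutionCost S) (S , refl)
    λ { (v , v≤S , (T , refl) , least) → none (v , v≤S , (T , ≈fromℕ (solutionCost-≗ℕ T)) , λ U →
      ≤-trans {fromℕ v} {fromℕ (solutionCost U)} {Solution.cost U}
        (fromℕ-mono {v} {solutionCost U} (least (solutionCost U) (U , refl))) (proj₂ (≈fromℕ (solutionCost-≗ℕ U)))) }

  -- The demand is nonempty, so at least one facility is assigned, and its distance is one term of
  -- the sum.
  serves⇒≤assignmentℕ : ∀ {R} fs A r → Serves line fs A r →
    All (λ x → R ℕ.≤ dist (proj₁ x) (location r)) fs → R ℕ.≤ assignmentℕ fs A r
  serves⇒≤assignmentℕ {R} fs A r serves far with serves (proj₂ (nonempty r))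
  ... | i , i∈A , _ = begin
    R                                                             ≤⟨ All.lookup far (∈-lookup {xs = fs} i) ⟩
    D i                                                           ≡⟨ cong (λ b → if b then D i else 0) (Vec.[]=⇒lookup i∈A) ⟨
    (if Vec.lookup A i then D i else 0)                           ≤⟨ term≤∑ℕ (λ i → if Vec.lookup A i then D i else 0) i ⟩
    assignmentℕ fs A r                                            ∎
    where
    open ℕ.≤-Reasoning
    D : Fin (length fs) → ℕ
    D i = dist (proj₁ (lookup fs i)) (location r)

  module Online (alg : OnlineAlgorithm line) where
    open OnlineAlgorithm alg hiding (cost)

    assignmentsℕ : List (Request line) → ℕ
    assignmentsℕ []      = 0
    assignmentsℕ (r ∷ h) = assignmentℕ (opened (r ∷ h)) (assigned r h) r ℕ.+ assignmentsℕ h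

    cost : List (Request line) → ℕ
    cost rs = length (opened rs) ℕ.* F ℕ.+ assignmentsℕ rs

    totalAssignmentCost-≗ℕ : ∀ rs → totalAssignmentCost rs ≗ℕ assignmentsℕ rs
    totalAssignmentCost-≗ℕ []      = fromℕ-≗ℕ
    totalAssignmentCost-≗ℕ (r ∷ h) =
      +-≗ℕ (assignmentCost-≗ℕ (opened (r ∷ h)) (assigned r h) r) (totalAssignmentCost-≗ℕ h)

    cost-≗ℕ : ∀ rs → OnlineAlgorithm.cost alg rs ≗ℕ cost rs
    cost-≗ℕ rs = +-≗ℕ (constructionCost-≗ℕ (opened rs)) (totalAssignmentCost-≗ℕ rs)

-- The adversary

-- The expectation over a uniformly random path, without the factor `2 ^ k` in the denominator, so
-- that it stays in ℕ.
∑paths : ∀ k → (Vec Bool k → ℕ) → ℕ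
∑paths zero    g = g []
∑paths (suc k) g = ∑paths k (λ b → g (false ∷ b)) ℕ.+ ∑paths k (λ b → g (true ∷ b))

-- The indicator of being outside the open ball of radius `r` around `x`. With open balls, centers
-- at distance `2 * r` give disjoint balls.
far : ℕ → ℕ → ℕ → ℕ
far r x p with r ℕ.≤? ℕ.∣ p - x ∣
... | yes _ = 1
... | no  _ = 0

far≤1 : ∀ r x p → far r x p ℕ.≤ 1
far≤1 r x p with r ℕ.≤? ℕ.∣ p - x ∣
... | yes _ = ℕ.≤-refl
... | no  _ = z≤n

far≡1 : ∀ {r x p} → r ℕ.≤ ℕ.∣ p - x ∣ → far r x p ≡ 1
far≡1 {r} {x} {p} h with r ℕ.≤? ℕ.∣ p - x ∣
... | yes _ = refl
... | no ¬h = ⊥-elim (¬h h)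

-- The balls of radius r around x and x + 2r are disjoint and both lie in the ball of radius R around x.
far-split : ∀ {r R} x p → 3 ℕ.* r ℕ.≤ R → suc (far R x p) ℕ.≤ far r x p ℕ.+ far r (x ℕ.+ 2 ℕ.* r) p
far-split {r} {R} x p 3r≤R with R ℕ.≤? ℕ.∣ p - x ∣
... | yes R≤ = ℕ.≤-reflexive (sym (cong₂ ℕ._+_ (far≡1 {r} {x} {p} (ℕ.≤-trans (ℕ.m≤m+n r _) 3r≤))
                                               (far≡1 {r} {x ℕ.+ 2 ℕ.* r} {p} r≤)))
  where
  open ℕ.≤-Reasoning
  3r≤ = ℕ.≤-trans 3r≤R R≤
  r≤ : r ℕ.≤ ℕ.∣ p - x ℕ.+ 2 ℕ.* r ∣
  r≤ = ℕ.+-cancelʳ-≤ (2 ℕ.* r) r _ (begin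
    r ℕ.+ 2 ℕ.* r                                                     ≤⟨ 3r≤ ⟩
    ℕ.∣ p - x ∣                                                       ≤⟨ ℕ.∣-∣-triangle p (x ℕ.+ 2 ℕ.* r) x ⟩
    ℕ.∣ p - x ℕ.+ 2 ℕ.* r ∣ ℕ.+ ℕ.∣ x ℕ.+ 2 ℕ.* r - x ∣               ≡⟨ cong (ℕ.∣ p - x ℕ.+ 2 ℕ.* r ∣ ℕ.+_) (trans (ℕ.∣-∣-comm (x ℕ.+ 2 ℕ.* r) x) (ℕ.∣m-m+n∣≡n x (2 ℕ.* r))) ⟩
    ℕ.∣ p - x ℕ.+ 2 ℕ.* r ∣ ℕ.+ 2 ℕ.* r                               ∎)
... | no _ with r ℕ.≤? ℕ.∣ p - x ∣ | r ℕ.≤? ℕ.∣ p - x ℕ.+ 2 ℕ.* r ∣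
...   | yes _ | _     = s≤s z≤n
...   | no _  | yes _ = ℕ.≤-refl
...   | no h  | no h′ = ⊥-elim (ℕ.<⇒≱ (ℕ.+-mono-< (ℕ.≰⇒> h) (ℕ.≰⇒> h′)) (begin
    r ℕ.+ r                                              ≡⟨ cong (r ℕ.+_) (ℕ.+-identityʳ r) ⟨
    2 ℕ.* r                                              ≡⟨ ℕ.∣m-m+n∣≡n x (2 ℕ.* r) ⟨
    ℕ.∣ x - x ℕ.+ 2 ℕ.* r ∣                              ≤⟨ ℕ.∣-∣-triangle x p (x ℕ.+ 2 ℕ.* r) ⟩
    ℕ.∣ x - p ∣ ℕ.+ ℕ.∣ p - x ℕ.+ 2 ℕ.* r ∣              ≡⟨ cong (ℕ._+ ℕ.∣ p - x ℕ.+ 2 ℕ.* r ∣) (ℕ.∣-∣-comm x p) ⟩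
    ℕ.∣ p - x ∣ ℕ.+ ℕ.∣ p - x ℕ.+ 2 ℕ.* r ∣              ∎))
  where open ℕ.≤-Reasoning

module Adversary (s : ℕ) .{{s≢0 : NonZero s}} (K : ℕ) .{{_ : NonZero K}} (F P q : ℕ) (3≤q : 3 ℕ.≤ q) where
  open OMFLP s
  open Line s K F P
  open Request

  -- Truncation at `P` makes the function total; the centers used below never exceed `P`.
  at : ℕ → Fin (suc P)
  at x = fromℕ< (s≤s (ℕ.m⊓n≤n x P))

  toℕ-at : ∀ {x} → x ℕ.≤ P → toℕ (at x) ≡ x
  toℕ-at {x} x≤P = trans (Fin.toℕ-fromℕ< (s≤s (ℕ.m⊓n≤n x P))) (ℕ.m≤n⇒m⊓n≡m x≤P)

  nonempty-⊤ : ∀ {m} .{{_ : NonZero m}} → Nonempty (⊤ {m})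
  nonempty-⊤ {suc m} = Fin.zero , Subset.∈⊤

  request : ℕ → Request line
  request x = record { location = at x ; demand = ⊤ ; nonempty = nonempty-⊤ }

  move : ℕ → ℕ → Bool → ℕ
  move r x false = x
  move r x true  = x ℕ.+ 2 ℕ.* r

  phase : ℕ → ℕ → List (Request line) → List (Request line)
  phase w x H = replicate w (request x) ++ H

  -- The request sequences and their offline cost

  module Paths (n : ℕ) where

    -- A node with k levels below it is a ball of radius q ^ k around x, which
    -- receives w requests unless k = 0; at the leaf, the sequence is padded to length n.
    final : ∀ {k} → Vec Bool k → ℕ → ℕ → List (Request line) → List (Request line)
    final {zero}  []      w x H = phase (n ℕ.∸ length H) x H
    final {suc k} (b ∷ p) w x H = final p (w ℕ.* q) (move (q ℕ.^ k) x b) (phase w x H)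

    leaf : ∀ {k} → Vec Bool k → ℕ → ℕ
    leaf {zero}  []      x = x
    leaf {suc k} (b ∷ p) x = leaf p (move (q ℕ.^ k) x b)

    -- Centers never move left, so only the right half of each ball has to fit onto the line.
    move-≤ : ∀ r x b → move r x b ℕ.+ r ℕ.≤ x ℕ.+ 3 ℕ.* r
    move-≤ r x false = ℕ.+-monoʳ-≤ x (ℕ.m≤m+n r _)
    move-≤ r x true  = ℕ.≤-reflexive (regroup x r)
      where
      regroup : ∀ x r → x ℕ.+ 2 ℕ.* r ℕ.+ r ≡ x ℕ.+ 3 ℕ.* r
      regroup = solve-∀

    move-≥ : ∀ r x b → x ℕ.≤ move r x b
    move-≥ r x false = ℕ.≤-refl
    move-≥ r x true  = ℕ.m≤m+n x _

    3r≤qr : ∀ r → 3 ℕ.* r ℕ.≤ q ℕ.* r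
    3r≤qr r = ℕ.*-monoˡ-≤ r 3≤q

    child-≤ : ∀ {k x} b → x ℕ.+ q ℕ.^ suc k ℕ.≤ P → move (q ℕ.^ k) x b ℕ.+ q ℕ.^ k ℕ.≤ P
    child-≤ {k} {x} b h = ℕ.≤-trans (move-≤ (q ℕ.^ k) x b) (ℕ.≤-trans (ℕ.+-monoʳ-≤ x (3r≤qr (q ℕ.^ k))) h)

    -- The number of requests grows by the factor `q` by which the radius shrinks, so the price `F`
    -- of serving one phase from outside its ball is the same on every level.
    child-cost : ∀ {k w} → w ℕ.* q ℕ.^ suc k ℕ.* K ≡ F → w ℕ.* q ℕ.* q ℕ.^ k ℕ.* K ≡ F
    child-cost {k} {w} h = trans (cong (ℕ._* K) (ℕ.*-assoc w q (q ℕ.^ k))) h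

    leaf-≥ : ∀ {k} (p : Vec Bool k) x → x ℕ.≤ leaf p x
    leaf-≥ {zero}  []      x = ℕ.≤-refl
    leaf-≥ {suc k} (b ∷ p) x = ℕ.≤-trans (move-≥ (q ℕ.^ k) x b) (leaf-≥ p _)

    leaf-≤ : ∀ {k} (p : Vec Bool k) x → leaf p x ℕ.≤ x ℕ.+ q ℕ.^ k
    leaf-≤ {zero}  []      x = ℕ.m≤m+n x 1
    leaf-≤ {suc k} (b ∷ p) x = ℕ.≤-trans (leaf-≤ p _) (ℕ.≤-trans (move-≤ (q ℕ.^ k) x b) (ℕ.+-monoʳ-≤ x (3r≤qr (q ℕ.^ k))))

    length-phase : ∀ w x H → length (phase w x H) ≡ w ℕ.+ length H
    length-phase w x H = trans (List.length-++ (replicate w (request x))) (cong (ℕ._+ length H) (List.length-replicate w))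

    -- The phases still to come have `w + w * q + … + w * q ^ (k - 1)` requests, at most
    -- `w * q ^ k - w` as `q ≥ 2`. The hypothesis says, without subtraction, that these fit into
    -- `n`, so the padding at the leaf is not cut off at zero.
    length-final : ∀ {k} (p : Vec Bool k) w x H → length H ℕ.+ w ℕ.* q ℕ.^ k ℕ.≤ n ℕ.+ w → length (final p w x H) ≡ n
    length-final {zero} [] w x H h = trans (length-phase (n ℕ.∸ length H) x H)
      (ℕ.m∸n+n≡m (ℕ.+-cancelʳ-≤ w (length H) n (subst (λ u → length H ℕ.+ u ℕ.≤ n ℕ.+ w) (ℕ.*-identityʳ w) h)))
    length-final {suc k} (b ∷ p) w x H h = length-final p (w ℕ.* q) (move (q ℕ.^ k) x b) (phase w x H) (begin
      length (phase w x H) ℕ.+ w ℕ.* q ℕ.* q ℕ.^ k   ≡⟨ cong₂ ℕ._+_ (length-phase w x H) (ℕ.*-assoc w q (q ℕ.^ k)) ⟩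
      w ℕ.+ length H ℕ.+ w ℕ.* q ℕ.^ suc k           ≡⟨ ℕ.+-assoc w (length H) _ ⟩
      w ℕ.+ (length H ℕ.+ w ℕ.* q ℕ.^ suc k)         ≤⟨ ℕ.+-monoʳ-≤ w h ⟩
      w ℕ.+ (n ℕ.+ w)                                ≡⟨ regroup w n ⟩
      n ℕ.+ w ℕ.* 2                                  ≤⟨ ℕ.+-monoʳ-≤ n (ℕ.*-monoʳ-≤ w (ℕ.≤-trans (ℕ.n≤1+n 2) 3≤q)) ⟩
      n ℕ.+ w ℕ.* q                                  ∎)
      where
      open ℕ.≤-Reasoning
      regroup : ∀ w n → w ℕ.+ (n ℕ.+ w) ≡ n ℕ.+ w ℕ.* 2
      regroup = solve-∀

    distances-phase : ∀ m w x H → distances m (phase w x H) ≡ w ℕ.* dist m (at x) ℕ.+ distances m H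
    distances-phase m zero    x H = refl
    distances-phase m (suc w) x H = trans (cong (dist m (at x) ℕ.+_) (distances-phase m w x H))
      (sym (ℕ.+-assoc (dist m (at x)) _ _))

    -- The leaf is within three sub-ball radii of each center above it, so each phase costs at most
    -- `3 * F` divided by `q`; multiplying by `q` avoids the division. The padding is located at the
    -- leaf and costs nothing.
    distances-final : ∀ {k} (p : Vec Bool k) w x H → w ℕ.* q ℕ.^ k ℕ.* K ≡ F → x ℕ.+ q ℕ.^ k ℕ.≤ P →
      q ℕ.* distances (at (leaf p x)) (final p w x H) ℕ.≤ k ℕ.* (3 ℕ.* F) ℕ.+ q ℕ.* distances (at (leaf p x)) H
    distances-final {zero} [] w x H _ _ = ℕ.≤-reflexive (cong (q ℕ.*_) (trans (distances-phase (at x) (n ℕ.∸ length H) x H)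
      (cong (ℕ._+ distances (at x) H) (trans (cong ((n ℕ.∸ length H) ℕ.*_)
        (trans (cong (K ℕ.*_) (ℕ.∣n-n∣≡0 (toℕ (at x)))) (ℕ.*-zeroʳ K))) (ℕ.*-zeroʳ (n ℕ.∸ length H))))))
    distances-final {suc k} (b ∷ p) w x H w≡ x≤ = begin
      q ℕ.* distances y (final p (w ℕ.* q) x′ H′)
        ≤⟨ distances-final p (w ℕ.* q) x′ H′ (child-cost {k} {w} w≡) (child-≤ {k} {x} b x≤) ⟩
      k ℕ.* (3 ℕ.* F) ℕ.+ q ℕ.* distances y H′
        ≡⟨ cong (λ u → k ℕ.* (3 ℕ.* F) ℕ.+ q ℕ.* u) (distances-phase y w x H) ⟩
      k ℕ.* (3 ℕ.* F) ℕ.+ q ℕ.* (w ℕ.* dist y (at x) ℕ.+ distances y H)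
        ≤⟨ ℕ.+-monoʳ-≤ (k ℕ.* (3 ℕ.* F)) (ℕ.*-monoʳ-≤ q (ℕ.+-monoˡ-≤ (distances y H) (ℕ.*-monoʳ-≤ w (ℕ.*-monoʳ-≤ K near)))) ⟩
      k ℕ.* (3 ℕ.* F) ℕ.+ q ℕ.* (w ℕ.* (K ℕ.* (3 ℕ.* q ℕ.^ k)) ℕ.+ distances y H)
        ≡⟨ regroup k q w K (q ℕ.^ k) F (distances y H) ⟩
      3 ℕ.* (w ℕ.* q ℕ.^ suc k ℕ.* K) ℕ.+ k ℕ.* (3 ℕ.* F) ℕ.+ q ℕ.* distances y H
        ≡⟨ cong (λ u → 3 ℕ.* u ℕ.+ k ℕ.* (3 ℕ.* F) ℕ.+ q ℕ.* distances y H) w≡ ⟩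
      suc k ℕ.* (3 ℕ.* F) ℕ.+ q ℕ.* distances y H ∎
      where
      open ℕ.≤-Reasoning
      x′ = move (q ℕ.^ k) x b
      H′ = phase w x H
      y  = at (leaf p x′)
      y≤ : leaf p x′ ℕ.≤ x ℕ.+ 3 ℕ.* q ℕ.^ k
      y≤ = ℕ.≤-trans (leaf-≤ p x′) (move-≤ (q ℕ.^ k) x b)
      x≤y : x ℕ.≤ leaf p x′
      x≤y = leaf-≥ (b ∷ p) x
      near : ℕ.∣ toℕ y - toℕ (at x) ∣ ℕ.≤ 3 ℕ.* q ℕ.^ k
      near = begin
        ℕ.∣ toℕ y - toℕ (at x) ∣
          ≡⟨ cong₂ ℕ.∣_-_∣ (toℕ-at (ℕ.≤-trans y≤ (ℕ.≤-trans (ℕ.+-monoʳ-≤ x (3r≤qr (q ℕ.^ k))) x≤)))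
                           (toℕ-at (ℕ.m+n≤o⇒m≤o x x≤)) ⟩
        ℕ.∣ leaf p x′ - x ∣
          ≡⟨ ℕ.m≤n⇒∣n-m∣≡n∸m x≤y ⟩
        leaf p x′ ℕ.∸ x
          ≤⟨ ℕ.m≤n+o⇒m∸n≤o (leaf p x′) x y≤ ⟩
        3 ℕ.* q ℕ.^ k ∎
      regroup : ∀ k q w K r F D → k ℕ.* (3 ℕ.* F) ℕ.+ q ℕ.* (w ℕ.* (K ℕ.* (3 ℕ.* r)) ℕ.+ D) ≡
                3 ℕ.* (w ℕ.* (q ℕ.* r) ℕ.* K) ℕ.+ k ℕ.* (3 ℕ.* F) ℕ.+ q ℕ.* D
      regroup = solve-∀

    -- Opening costs `F`, and at most `q` phases each contribute at most `3 * F` divided by `q`.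
    optimum≤4F : ∀ {k} (p : Vec Bool k) → k ℕ.≤ q → q ℕ.^ k ℕ.* K ≡ F → q ℕ.^ k ℕ.≤ P →
      solutionCost (singleFacility (at (leaf p 0)) (final p 1 0 [])) ℕ.≤ 4 ℕ.* F
    optimum≤4F {k} p k≤q q≡ q≤ = begin
      solutionCost (singleFacility y (final p 1 0 []))   ≡⟨ singleFacility-cost y (final p 1 0 []) ⟩
      F ℕ.+ D                                            ≤⟨ ℕ.+-monoʳ-≤ F (ℕ.*-cancelˡ-≤ q {{ℕ.>-nonZero (ℕ.≤-trans (s≤s z≤n) 3≤q)}} qD≤) ⟩
      F ℕ.+ 3 ℕ.* F                                      ∎
      where
      open ℕ.≤-Reasoning
      y = at (leaf p 0)
      D = distances y (final p 1 0 [])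
      qD≤ : q ℕ.* D ℕ.≤ q ℕ.* (3 ℕ.* F)
      qD≤ = begin
        q ℕ.* D                            ≤⟨ distances-final p 1 0 [] (trans (cong (ℕ._* K) (ℕ.*-identityˡ (q ℕ.^ k))) q≡) q≤ ⟩
        k ℕ.* (3 ℕ.* F) ℕ.+ q ℕ.* 0        ≡⟨ cong (k ℕ.* (3 ℕ.* F) ℕ.+_) (ℕ.*-zeroʳ q) ⟩
        k ℕ.* (3 ℕ.* F) ℕ.+ 0              ≡⟨ ℕ.+-identityʳ _ ⟩
        k ℕ.* (3 ℕ.* F)                    ≤⟨ ℕ.*-monoˡ-≤ (3 ℕ.* F) k≤q ⟩
        q ℕ.* (3 ℕ.* F)                    ∎

    -- Lower bound for a deterministic online algorithm

    module Lower (alg : OnlineAlgorithm line) where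
      open OnlineAlgorithm alg using (opens; opened; assigned; serves)
      open Online alg

      outside : ℕ → ℕ → List (Facility line) → ℕ
      outside r x fs = sum (map (λ (m , _) → far r x (toℕ m)) fs)

      outside-++ : ∀ r x fs gs → outside r x (fs ++ gs) ≡ outside r x fs ℕ.+ outside r x gs
      outside-++ r x fs gs = trans (cong sum (List.map-++ _ fs gs)) (sum-++ (map _ fs) (map _ gs))

      outside≤length : ∀ r x fs → outside r x fs ℕ.≤ length fs
      outside≤length r x []             = z≤n
      outside≤length r x ((m , _) ∷ fs) = ℕ.+-mono-≤ (far≤1 r x (toℕ m)) (outside≤length r x fs)

      outside-split : ∀ {r R} x fs → 3 ℕ.* r ℕ.≤ R →
        length fs ℕ.+ outside R x fs ℕ.≤ outside r x fs ℕ.+ outside r (x ℕ.+ 2 ℕ.* r) fs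
      outside-split x []             _ = z≤n
      outside-split {r} {R} x ((m , _) ∷ fs) h = begin
        suc (length fs) ℕ.+ (far R x (toℕ m) ℕ.+ outside R x fs)
          ≡⟨ regroup₁ (length fs) (far R x (toℕ m)) (outside R x fs) ⟩
        suc (far R x (toℕ m)) ℕ.+ (length fs ℕ.+ outside R x fs)
          ≤⟨ ℕ.+-mono-≤ (far-split {r} {R} x (toℕ m) h) (outside-split {r} {R} x fs h) ⟩
        far r x (toℕ m) ℕ.+ far r x′ (toℕ m) ℕ.+ (outside r x fs ℕ.+ outside r x′ fs)
          ≡⟨ regroup₂ (far r x (toℕ m)) _ (outside r x fs) _ ⟩
        far r x (toℕ m) ℕ.+ outside r x fs ℕ.+ (far r x′ (toℕ m) ℕ.+ outside r x′ fs) ∎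
        where
        open ℕ.≤-Reasoning
        x′ = x ℕ.+ 2 ℕ.* r
        regroup₁ : ∀ l f o → suc l ℕ.+ (f ℕ.+ o) ≡ suc f ℕ.+ (l ℕ.+ o)
        regroup₁ = solve-∀
        regroup₂ : ∀ a b c d → a ℕ.+ b ℕ.+ (c ℕ.+ d) ≡ a ℕ.+ c ℕ.+ (b ℕ.+ d)
        regroup₂ = solve-∀

      Far : ℕ → ℕ → List (Facility line) → Set
      Far R x = All λ (m , _) → R ℕ.≤ ℕ.∣ toℕ m - x ∣

      far? : ∀ R x fs → Far R x fs ⊎ suc (outside R x fs) ℕ.≤ length fs
      far? R x [] = inj₁ []
      far? R x ((m , _) ∷ fs) with R ℕ.≤? ℕ.∣ toℕ m - x ∣ | far? R x fs
      ... | yes h | inj₁ hs = inj₁ (h ∷ hs)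
      ... | yes _ | inj₂ l  = inj₂ (s≤s l)
      ... | no _  | _       = inj₂ (s≤s (outside≤length R x fs))

      outside-mono : ∀ r x rs H → outside r x (opened H) ℕ.≤ outside r x (opened (rs ++ H))
      outside-mono r x []        H = ℕ.≤-refl
      outside-mono r x (r′ ∷ rs) H = ℕ.≤-trans (outside-mono r x rs H) (ℕ.≤-trans (ℕ.m≤n+m _ _)
        (ℕ.≤-reflexive (sym (outside-++ r x (opens r′ (rs ++ H)) (opened (rs ++ H))))))

      assignmentsℕ-mono : ∀ rs H → assignmentsℕ H ℕ.≤ assignmentsℕ (rs ++ H)
      assignmentsℕ-mono []       H = ℕ.≤-refl
      assignmentsℕ-mono (r ∷ rs) H = ℕ.≤-trans (assignmentsℕ-mono rs H) (ℕ.m≤n+m _ _)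

      -- Being far is assumed only at the end of the phase: the facilities open at an earlier
      -- arrival form a suffix of the final list, so they are far as well.
      assignmentsℕ-phase : ∀ {R x} w H → x ℕ.≤ P → Far R x (opened (phase w x H)) →
        w ℕ.* (K ℕ.* R) ℕ.+ assignmentsℕ H ℕ.≤ assignmentsℕ (phase w x H)
      assignmentsℕ-phase zero H _ _ = ℕ.≤-refl
      assignmentsℕ-phase {R} {x} (suc w) H x≤P allFar = ℕ.≤-trans (ℕ.≤-reflexive (ℕ.+-assoc (K ℕ.* R) _ _)) (ℕ.+-mono-≤
        (serves⇒≤assignmentℕ (opened (phase (suc w) x H)) (assigned (request x) (phase w x H)) (request x)
          (serves (request x) (phase w x H))
          (All.map (λ {(m , _)} h → ℕ.*-monoʳ-≤ K (ℕ.≤-trans h (ℕ.≤-reflexive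
            (cong (λ u → ℕ.∣ toℕ m - u ∣) (sym (toℕ-at x≤P)))))) allFar))
        (assignmentsℕ-phase w H x≤P (All.++⁻ʳ (opens (request x) (phase w x H)) allFar)))

      -- The part of the cost that does not depend on the moves below the ball.
      charge : ℕ → ℕ → List (Request line) → ℕ
      charge r x H = assignmentsℕ H ℕ.+ outside r x (opened H) ℕ.* F

      charge≤cost : ∀ r x rs H → charge r x H ℕ.≤ cost (rs ++ H)
      charge≤cost r x rs H = ℕ.≤-trans (ℕ.≤-reflexive (ℕ.+-comm (assignmentsℕ H) _)) (ℕ.+-mono-≤
        (ℕ.*-monoˡ-≤ F (ℕ.≤-trans (outside-mono r x rs H) (outside≤length r x (opened (rs ++ H)))))
        (assignmentsℕ-mono rs H))

      -- Either no facility lies in the ball of radius R, and the w requests pay F,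
      -- or some facility does, and it is outside one of the two smaller balls.
      charge-phase : ∀ {r R x} w H → 3 ℕ.* r ℕ.≤ R → x ℕ.≤ P → w ℕ.* R ℕ.* K ≡ F →
        2 ℕ.* charge R x H ℕ.+ F ℕ.≤ charge r x (phase w x H) ℕ.+ charge r (x ℕ.+ 2 ℕ.* r) (phase w x H)
      charge-phase {r} {R} {x} w H 3r≤R x≤P w≡ = begin
        2 ℕ.* (a ℕ.+ o ℕ.* F) ℕ.+ F
          ≤⟨ enough (far? R x fs) ⟩
        2 ℕ.* a′ ℕ.+ (length fs ℕ.+ outside R x fs) ℕ.* F
          ≤⟨ ℕ.+-monoʳ-≤ (2 ℕ.* a′) (ℕ.*-monoˡ-≤ F (outside-split {r} {R} x fs 3r≤R)) ⟩
        2 ℕ.* a′ ℕ.+ (outside r x fs ℕ.+ outside r x′ fs) ℕ.* F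
          ≡⟨ regroup a′ (outside r x fs) (outside r x′ fs) F ⟩
        a′ ℕ.+ outside r x fs ℕ.* F ℕ.+ (a′ ℕ.+ outside r x′ fs ℕ.* F) ∎
        where
        open ℕ.≤-Reasoning
        x′ = x ℕ.+ 2 ℕ.* r
        fs = opened (phase w x H)
        a  = assignmentsℕ H
        a′ = assignmentsℕ (phase w x H)
        o  = outside R x (opened H)
        o≤ : o ℕ.≤ outside R x fs
        o≤ = outside-mono R x (replicate w (request x)) H
        regroup : ∀ a b c F → 2 ℕ.* a ℕ.+ (b ℕ.+ c) ℕ.* F ≡ a ℕ.+ b ℕ.* F ℕ.+ (a ℕ.+ c ℕ.* F)
        regroup = solve-∀
        regroup₁ : ∀ a o F → 2 ℕ.* (a ℕ.+ o ℕ.* F) ℕ.+ F ≡ a ℕ.+ (F ℕ.+ a) ℕ.+ (o ℕ.+ o) ℕ.* F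
        regroup₁ = solve-∀
        regroup₂ : ∀ a o F → 2 ℕ.* (a ℕ.+ o ℕ.* F) ℕ.+ F ≡ 2 ℕ.* a ℕ.+ (suc o ℕ.+ o) ℕ.* F
        regroup₂ = solve-∀
        enough : Far R x fs ⊎ suc (outside R x fs) ℕ.≤ length fs →
          2 ℕ.* (a ℕ.+ o ℕ.* F) ℕ.+ F ℕ.≤ 2 ℕ.* a′ ℕ.+ (length fs ℕ.+ outside R x fs) ℕ.* F
        enough (inj₁ allFar) = begin
          2 ℕ.* (a ℕ.+ o ℕ.* F) ℕ.+ F
            ≡⟨ regroup₁ a o F ⟩
          a ℕ.+ (F ℕ.+ a) ℕ.+ (o ℕ.+ o) ℕ.* F
            ≤⟨ ℕ.+-mono-≤ (ℕ.+-mono-≤ (assignmentsℕ-mono (replicate w (request x)) H) (ℕ.≤-trans F+a≤ (ℕ.m≤m+n a′ 0)))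
                 (ℕ.*-monoˡ-≤ F (ℕ.+-mono-≤ (ℕ.≤-trans o≤ (outside≤length R x fs)) o≤)) ⟩
          2 ℕ.* a′ ℕ.+ (length fs ℕ.+ outside R x fs) ℕ.* F ∎
          where
          F≡ : F ≡ w ℕ.* (K ℕ.* R)
          F≡ = trans (sym w≡) (trans (ℕ.*-assoc w R K) (cong (w ℕ.*_) (ℕ.*-comm R K)))
          F+a≤ : F ℕ.+ a ℕ.≤ a′
          F+a≤ = ℕ.≤-trans (ℕ.≤-reflexive (cong (ℕ._+ a) F≡)) (assignmentsℕ-phase w H x≤P allFar)
        enough (inj₂ l) = begin
          2 ℕ.* (a ℕ.+ o ℕ.* F) ℕ.+ F
            ≡⟨ regroup₂ a o F ⟩
          2 ℕ.* a ℕ.+ (suc o ℕ.+ o) ℕ.* F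
            ≤⟨ ℕ.+-mono-≤ (ℕ.*-monoʳ-≤ 2 (assignmentsℕ-mono (replicate w (request x)) H))
                 (ℕ.*-monoˡ-≤ F (ℕ.+-mono-≤ (ℕ.≤-trans (s≤s o≤) l) o≤)) ⟩
          2 ℕ.* a′ ℕ.+ (length fs ℕ.+ outside R x fs) ℕ.* F ∎

      -- Induction from the leaves up: by `charge-phase`, the charge of a ball plus `F / 2` is at
      -- most the average charge of its two sub-balls. Both sub-balls share the history `H′`,
      -- because the algorithm serves the phase before learning which one is chosen. All is doubled
      -- to keep `F / 2` in ℕ.
      ∑cost-≥ : ∀ k w x H → w ℕ.* q ℕ.^ k ℕ.* K ≡ F → x ℕ.+ q ℕ.^ k ℕ.≤ P →
        2 ℕ.^ k ℕ.* (2 ℕ.* charge (q ℕ.^ k) x H ℕ.+ k ℕ.* F) ℕ.≤ 2 ℕ.* ∑paths k (λ p → cost (final p w x H))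
      ∑cost-≥ zero w x H _ _ = ℕ.≤-trans
        (ℕ.≤-reflexive (trans (ℕ.*-identityˡ _) (ℕ.+-identityʳ (2 ℕ.* charge 1 x H))))
        (ℕ.*-monoʳ-≤ 2 (charge≤cost 1 x (replicate (n ℕ.∸ length H) (request x)) H))
      ∑cost-≥ (suc k) w x H w≡ x≤ = begin
        2 ℕ.^ suc k ℕ.* (2 ℕ.* c ℕ.+ suc k ℕ.* F)
          ≡⟨ regroup₁ (2 ℕ.^ k) c k F ⟩
        2 ℕ.^ k ℕ.* (2 ℕ.* (2 ℕ.* c ℕ.+ F) ℕ.+ 2 ℕ.* (k ℕ.* F))
          ≤⟨ ℕ.*-monoʳ-≤ (2 ℕ.^ k) (ℕ.+-monoˡ-≤ (2 ℕ.* (k ℕ.* F)) (ℕ.*-monoʳ-≤ 2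
               (charge-phase {q ℕ.^ k} {q ℕ.^ suc k} w H (3r≤qr (q ℕ.^ k)) (ℕ.m+n≤o⇒m≤o x x≤) w≡))) ⟩
        2 ℕ.^ k ℕ.* (2 ℕ.* (c₀ ℕ.+ c₁) ℕ.+ 2 ℕ.* (k ℕ.* F))
          ≡⟨ regroup₂ (2 ℕ.^ k) c₀ c₁ (k ℕ.* F) ⟩
        2 ℕ.^ k ℕ.* (2 ℕ.* c₀ ℕ.+ k ℕ.* F) ℕ.+ 2 ℕ.^ k ℕ.* (2 ℕ.* c₁ ℕ.+ k ℕ.* F)
          ≤⟨ ℕ.+-mono-≤ (∑cost-≥ k (w ℕ.* q) x H′ (child-cost {k} {w} w≡) (child-≤ {k} {x} false x≤))
                        (∑cost-≥ k (w ℕ.* q) x′ H′ (child-cost {k} {w} w≡) (child-≤ {k} {x} true x≤)) ⟩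
        2 ℕ.* ∑₀ ℕ.+ 2 ℕ.* ∑₁
          ≡⟨ ℕ.*-distribˡ-+ 2 ∑₀ ∑₁ ⟨
        2 ℕ.* (∑₀ ℕ.+ ∑₁) ∎
        where
        open ℕ.≤-Reasoning
        x′ = x ℕ.+ 2 ℕ.* q ℕ.^ k
        H′ = phase w x H
        c  = charge (q ℕ.^ suc k) x H
        c₀ = charge (q ℕ.^ k) x H′
        c₁ = charge (q ℕ.^ k) x′ H′
        ∑₀ = ∑paths k (λ p → cost (final p (w ℕ.* q) x H′))
        ∑₁ = ∑paths k (λ p → cost (final p (w ℕ.* q) x′ H′))
        regroup₁ : ∀ t c k F → 2 ℕ.* t ℕ.* (2 ℕ.* c ℕ.+ suc k ℕ.* F) ≡ t ℕ.* (2 ℕ.* (2 ℕ.* c ℕ.+ F) ℕ.+ 2 ℕ.* (k ℕ.* F))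
        regroup₁ = solve-∀
        regroup₂ : ∀ t c d e → t ℕ.* (2 ℕ.* (c ℕ.+ d) ℕ.+ 2 ℕ.* e) ≡ t ℕ.* (2 ℕ.* c ℕ.+ e) ℕ.+ t ℕ.* (2 ℕ.* d ℕ.+ e)
        regroup₂ = solve-∀

-- Averaging over the paths of the adversary

module Expectation (space : ProbabilitySpace) where
  open ProbabilitySpace space

  ExpectationAtMost : ℝ → (Ω → ℝ) → Set
  ExpectationAtMost b X = Σ[ i ∈ Integrable X ] 𝔼 i ≤ b

  expectation-resp : ∀ {b X Y} → (∀ ω → X ω ≈ Y ω) → ExpectationAtMost b X → ExpectationAtMost b Y
  expectation-resp {b} {X} {Y} X≈Y (i , 𝔼≤b) = j ,
    ≤-trans {𝔼 j} {𝔼 i} {b} (𝔼-mono j i (λ ω → proj₂ (X≈Y ω))) 𝔼≤b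
    where
    j : Integrable Y
    j = integrable-resp X≈Y i

  expectation-+ : ∀ {m n} {X Y : Ω → ℕ} →
    ExpectationAtMost (fromℕ m) (λ ω → fromℕ (X ω)) → ExpectationAtMost (fromℕ n) (λ ω → fromℕ (Y ω)) →
    ExpectationAtMost (fromℕ (m ℕ.+ n)) (λ ω → fromℕ (X ω ℕ.+ Y ω))
  expectation-+ {m} {n} {X} {Y} (i , h) (j , k) = expectation-resp {fromℕ (m ℕ.+ n)}
    (λ ω → ≈-sym {fromℕ (X ω ℕ.+ Y ω)} {fromℕ (X ω) + fromℕ (Y ω)} (fromℕ-+ (X ω) (Y ω)))
    (integrable-+ i j ,
      ≤-trans {𝔼 (integrable-+ i j)} {𝔼 i + 𝔼 j} {fromℕ (m ℕ.+ n)} (proj₁ (𝔼-+ i j))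
        (≤-trans {𝔼 i + 𝔼 j} {fromℕ m + fromℕ n} {fromℕ (m ℕ.+ n)}
          (+-mono-≤ {𝔼 i} {fromℕ m} {𝔼 j} {fromℕ n} h k) (proj₂ (fromℕ-+ m n))))

  -- There are finitely many paths, so their double negations can be combined one after the other.
  -- This is needed because the optimum of each path exists only up to double negation.
  expectation-∑paths : ∀ k {b} (X : Vec Bool k → Ω → ℕ) →
    (∀ p → ¬ ¬ ExpectationAtMost (fromℕ b) (λ ω → fromℕ (X p ω))) →
    ¬ ¬ ExpectationAtMost (fromℕ (2 ℕ.^ k ℕ.* b)) (λ ω → fromℕ (∑paths k (λ p → X p ω)))
  expectation-∑paths zero    {b} X h none =
    h [] λ e → none (subst (λ u → ExpectationAtMost (fromℕ u) (λ ω → fromℕ (X [] ω))) (sym (ℕ.*-identityˡ b)) e)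
  expectation-∑paths (suc k) {b} X h none =
    expectation-∑paths k (λ p → X (false ∷ p)) (λ p → h (false ∷ p)) λ e₀ →
    expectation-∑paths k (λ p → X (true ∷ p)) (λ p → h (true ∷ p)) λ e₁ →
    none (subst (λ u → ExpectationAtMost (fromℕ u) (λ ω → fromℕ (∑paths (suc k) (λ p → X p ω)))) (double (2 ℕ.^ k) b)
      (expectation-+ {2 ℕ.^ k ℕ.* b} {2 ℕ.^ k ℕ.* b} {X₀} {X₁} e₀ e₁))
    where
    X₀ X₁ : Ω → ℕ
    X₀ ω = ∑paths k (λ p → X (false ∷ p) ω)
    X₁ ω = ∑paths k (λ p → X (true ∷ p) ω)
    double : ∀ t b → t ℕ.* b ℕ.+ t ℕ.* b ≡ 2 ℕ.* t ℕ.* b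
    double = solve-∀

  -- The averaging step of Yao's principle: a bound valid for every outcome of the algorithm's
  -- randomness passes to the expectation by monotonicity and `𝔼-const`.
  lower≤upper : ∀ {m n} {X : Ω → ℕ} → (∀ ω → m ℕ.≤ X ω) → ExpectationAtMost (fromℕ n) (λ ω → fromℕ (X ω)) → m ℕ.≤ n
  lower≤upper {m} {n} {X} m≤X (i , h) = fromℕ-cancel {m} {n} (≤-trans {fromℕ m} {𝔼 (integrable-const (fromℕ m))} {fromℕ n}
    (proj₂ (𝔼-const (fromℕ m))) (≤-trans {𝔼 (integrable-const (fromℕ m))} {𝔼 i} {fromℕ n}
      (𝔼-mono (integrable-const (fromℕ m)) i λ ω → fromℕ-mono {m} {X ω} (m≤X ω)) h))

-- The constant and the contradiction

κ₀ : ℝ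
κ₀ = fromℚ (1 // 80)

0<κ₀ : 0ℝ < κ₀
0<κ₀ = (1 // 80) , ℚ.positive⁻¹ (1 // 80) , 0 , λ n _ → ℚ.≤-reflexive (trans
  (cong (ℚ._+ (1 // 80)) (seq-fromℚ 0ℚ n)) (trans (ℚ.+-identityˡ (1 // 80)) (sym (seq-fromℚ (1 // 80) n))))

-- With κ₀ = 1/80, the bound κ₀ (5 h) on the ratio and 4 F = 16 M on the optimum give cost h M.
κ₀*5h*16M : ∀ h M → (1 // 80) ℚ.* ((5 ℕ.* h) // 1) ℚ.* ((16 ℕ.* M) // 1) ≡ (h ℕ.* M) // 1
κ₀*5h*16M h M = begin
  (1 // 80) ℚ.* ((5 ℕ.* h) // 1) ℚ.* ((16 ℕ.* M) // 1)    ≡⟨ ℚ.*-assoc (1 // 80) ((5 ℕ.* h) // 1) ((16 ℕ.* M) // 1) ⟩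
  (1 // 80) ℚ.* (((5 ℕ.* h) // 1) ℚ.* ((16 ℕ.* M) // 1))  ≡⟨ cong ((1 // 80) ℚ.*_) (sym (//1-* (5 ℕ.* h) (16 ℕ.* M))) ⟩
  (1 // 80) ℚ.* ((5 ℕ.* h ℕ.* (16 ℕ.* M)) // 1)           ≡⟨ cong (λ u → (1 // 80) ℚ.* (u // 1)) (collect h M) ⟩
  (1 // 80) ℚ.* ((80 ℕ.* (h ℕ.* M)) // 1)                 ≡⟨ cong ((1 // 80) ℚ.*_) (//1-* 80 (h ℕ.* M)) ⟩
  (1 // 80) ℚ.* ((80 // 1) ℚ.* ((h ℕ.* M) // 1))          ≡⟨ ℚ.*-assoc (1 // 80) (80 // 1) ((h ℕ.* M) // 1) ⟨
  1ℚ ℚ.* ((h ℕ.* M) // 1)                                 ≡⟨ ℚ.*-identityˡ ((h ℕ.* M) // 1) ⟩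
  (h ℕ.* M) // 1                                          ∎
  where
  open ≡-Reasoning
  collect : ∀ h M → 5 ℕ.* h ℕ.* (16 ℕ.* M) ≡ 80 ℕ.* (h ℕ.* M)
  collect = solve-∀

module _ (s : ℕ) .{{_ : NonZero s}} (𝒜 : OMFLP.RandomizedAlgorithm s) where
  open OMFLP s
  open RandomizedAlgorithm 𝒜
  open Expectation space

  -- With such a ratio, every path would have expected cost at most `h * M + a′`. The average over
  -- the paths is at least `h * F / 2`, which is `2 * (h * M)`, and `a′ < M`.
  ratio-≰ : (c : ℕ → ℕ → ℝ) → CompetitiveOnLines 𝒜 c → ∀ n (h q : ℕ) →
    3 ℕ.≤ q → 0 ℕ.< h → h ℕ.≤ q → q ℕ.^ h ℕ.≤ n → ¬ (c s n ≤ fromℚ ((1 // 80) ℚ.* ((5 ℕ.* h) // 1)))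
  ratio-≰ c (a , competitive) n h q 3≤q 0<h h≤q q^h≤n c≤ρ =
    expectation-∑paths h {b} onlineCost path-bound λ e → ℕ.<⇒≱ b<2hM
      (ℕ.*-cancelˡ-≤ (2 ℕ.^ h) {{ℕ.m^n≢0 2 h}} (lower≤upper {2 ℕ.^ h ℕ.* (2 ℕ.* (h ℕ.* M))} {2 ℕ.^ h ℕ.* b} average-≥ e))
    where
    ρ = (1 // 80) ℚ.* ((5 ℕ.* h) // 1)
    a′ = proj₁ (≤-fromℕ a)
    K P F M b : ℕ
    -- The factor `suc a′` makes `M` exceed the additive constant; the factor 4 makes `F / 2` the
    -- integer `2 * M`.
    K = 4 ℕ.* suc a′
    P = q ℕ.^ h
    F = q ℕ.^ h ℕ.* K
    M = suc a′ ℕ.* q ℕ.^ h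
    b = h ℕ.* M ℕ.+ a′
    F≡4M : F ≡ 4 ℕ.* M
    F≡4M = regroup (q ℕ.^ h) a′
      where
      regroup : ∀ r a → r ℕ.* (4 ℕ.* suc a) ≡ 4 ℕ.* (suc a ℕ.* r)
      regroup = solve-∀
    open Line s K F P
    open Adversary s K F P q 3≤q
    open Paths n
    requests : Vec Bool h → List (Request line)
    requests p = final p 1 0 []
    length-requests : ∀ p → length (requests p) ≡ n
    length-requests p = length-final p 1 0 [] (ℕ.≤-trans (ℕ.≤-reflexive (ℕ.*-identityˡ (q ℕ.^ h)))
      (ℕ.≤-trans q^h≤n (ℕ.m≤m+n n 1)))
    onlineCost : Vec Bool h → Ω → ℕ
    onlineCost p ω = Online.cost (algorithm ω line) (requests p)
    average-≥ : ∀ ω → 2 ℕ.^ h ℕ.* (2 ℕ.* (h ℕ.* M)) ℕ.≤ ∑paths h (λ p → onlineCost p ω)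
    average-≥ ω = ℕ.*-cancelˡ-≤ 2 (begin
      2 ℕ.* (2 ℕ.^ h ℕ.* (2 ℕ.* (h ℕ.* M)))            ≡⟨ regroup (2 ℕ.^ h) h M ⟩
      2 ℕ.^ h ℕ.* (h ℕ.* (4 ℕ.* M))                    ≡⟨ cong (λ u → 2 ℕ.^ h ℕ.* (h ℕ.* u)) F≡4M ⟨
      2 ℕ.^ h ℕ.* (h ℕ.* F)                            ≤⟨ ℕ.*-monoʳ-≤ (2 ℕ.^ h) (ℕ.m≤n+m (h ℕ.* F) _) ⟩
      2 ℕ.^ h ℕ.* (2 ℕ.* charge P 0 [] ℕ.+ h ℕ.* F)    ≤⟨ ∑cost-≥ h 1 0 [] (cong (ℕ._* K) (ℕ.*-identityˡ P)) ℕ.≤-refl ⟩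
      2 ℕ.* ∑paths h (λ p → onlineCost p ω)            ∎)
      where
      open ℕ.≤-Reasoning
      open Lower (algorithm ω line)
      regroup : ∀ t h M → 2 ℕ.* (t ℕ.* (2 ℕ.* (h ℕ.* M))) ≡ t ℕ.* (h ℕ.* (4 ℕ.* M))
      regroup = solve-∀
    b<2hM : b ℕ.< 2 ℕ.* (h ℕ.* M)
    b<2hM = begin-strict
      h ℕ.* M ℕ.+ a′                   <⟨ ℕ.+-monoʳ-< (h ℕ.* M) (begin-strict
        a′                               <⟨ ℕ.n<1+n a′ ⟩
        suc a′                           ≡⟨ ℕ.*-identityʳ (suc a′) ⟨
        suc a′ ℕ.* 1                     ≤⟨ ℕ.*-monoʳ-≤ (suc a′) (ℕ.m^n>0 q {{ℕ.>-nonZero (ℕ.≤-trans (s≤s z≤n) 3≤q)}} h) ⟩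
        M                                ≡⟨ ℕ.*-identityˡ M ⟨
        1 ℕ.* M                          ≤⟨ ℕ.*-monoˡ-≤ M 0<h ⟩
        h ℕ.* M                          ≡⟨ ℕ.+-identityʳ _ ⟨
        h ℕ.* M ℕ.+ 0                    ∎) ⟩
      2 ℕ.* (h ℕ.* M)                  ∎
      where open ℕ.≤-Reasoning
    cv≤hM : ∀ v → v ℕ.≤ 4 ℕ.* F → c s n * fromℕ v ≤ fromℕ (h ℕ.* M)
    cv≤hM v v≤4F = ≤-trans {c s n * fromℕ v} {fromℚ (ρ ℚ.* (v // 1))} {fromℕ (h ℕ.* M)}
      (*-fromℚ-≤ {c s n} {ρ} {v // 1} (//1-mono {0} {v} z≤n) c≤ρ)
      (seq-≤⇒≤ {fromℚ (ρ ℚ.* (v // 1))} {fromℕ (h ℕ.* M)} λ k →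
        subst₂ ℚ._≤_ (sym (seq-fromℚ _ k)) (sym (seq-fromℚ _ k)) (ℚ.≤-trans
          (ℚ.*-monoˡ-≤-nonNeg ρ {{ℚ.nonNegative 0≤ρ}} (//1-mono {v} {16 ℕ.* M} v≤16M))
          (ℚ.≤-reflexive (κ₀*5h*16M h M))))
      where
      v≤16M : v ℕ.≤ 16 ℕ.* M
      v≤16M = ℕ.≤-trans v≤4F (ℕ.≤-reflexive (trans (cong (4 ℕ.*_) F≡4M) (sym (ℕ.*-assoc 4 4 M))))
      0≤ρ : 0ℚ ℚ.≤ ρ
      0≤ρ = ℚ.≤-trans (ℚ.≤-reflexive (sym (ℚ.*-zeroʳ (1 // 80))))
        (ℚ.*-monoˡ-≤-nonNeg (1 // 80) (//1-mono {0} {5 ℕ.* h} z≤n))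
    path-bound : ∀ p → ¬ ¬ ExpectationAtMost (fromℕ b) (λ ω → fromℕ (onlineCost p ω))
    path-bound p none = ¬¬-OPT rs (singleFacility (at (leaf p 0)) rs) λ { (v , v≤ , opt) →
      let i , 𝔼≤ = competitive line onLine rs (fromℕ v) opt in
      none (expectation-resp {fromℕ b} (λ ω → ≈fromℕ (Online.cost-≗ℕ (algorithm ω line) rs)) (i ,
        ≤-trans {𝔼 i} {c s (length rs) * fromℕ v + a} {fromℕ b} 𝔼≤
          -- The padding gives every sequence length exactly `n`, so the ratio in question is
          -- `c s n`.
          (subst (λ l → c s l * fromℕ v + a ≤ fromℕ b) (sym (length-requests p))
            (≤-trans {c s n * fromℕ v + a} {fromℕ (h ℕ.* M) + fromℕ a′} {fromℕ b}
              (+-mono-≤ {c s n * fromℕ v} {fromℕ (h ℕ.* M)} {a} {fromℕ a′}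
                (cv≤hM v (ℕ.≤-trans v≤ (optimum≤4F p h≤q refl ℕ.≤-refl))) (proj₂ (≤-fromℕ a)))
              (proj₂ (fromℕ-+ (h ℕ.* M) a′)))))) }
      where
      rs = requests p

corollary3 : Σ[ κ ∈ ℝ ] 0ℝ < κ ×
    (∀ (s : ℕ) .{{_ : NonZero s}} (A : OMFLP.RandomizedAlgorithm s) (c : ℕ → ℕ → ℝ) →
    OMFLP.CompetitiveOnLines s A c →
    ∃[ N ] ∀ n (4≤n : 4 ℕ.≤ n) → N ℕ.≤ n →
    κ * (√ s + log₂ (fromℕ n) ÷ log₂ (log₂ (fromℕ n)) [ 0<log₂log₂ 4≤n ]) ≤ c s n)
corollary3 = κ₀ , 0<κ₀ , λ s A c competitive → threshold s , λ n 4≤n N≤n →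
  let open Parameters s n N≤n
      bound = √ s + log₂ (fromℕ n) ÷ log₂ (log₂ (fromℕ n)) [ 0<log₂log₂ 4≤n ]
  -- It remains to refute the reverse inequality, which would bound the ratio by `κ₀` times
  -- `5 * depth`.
  in ≰⇒≥ {c s n} {κ₀ * bound} λ c≤κ₀bound →
    ratio-≰ s A c competitive n depth base 3≤base 0<depth depth≤base base^depth≤n
      (≤-trans {c s n} {κ₀ * bound} {fromℚ ((1 // 80) ℚ.* ((5 ℕ.* depth) // 1))} c≤κ₀bound
        (≤-trans {κ₀ * bound} {κ₀ * fromℕ (5 ℕ.* depth)} {fromℚ ((1 // 80) ℚ.* ((5 ℕ.* depth) // 1))}
          (*-monoʳ-≤ {1 // 80} {bound} {fromℕ (5 ℕ.* depth)} (ℚ.<⇒≤ (ℚ.positive⁻¹ (1 // 80))) (bound≤5*depth 4≤n))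
          (*-fromℚ-≤ {κ₀} {1 // 80} {(5 ℕ.* depth) // 1} (//1-mono {0} {5 ℕ.* depth} z≤n) (≤-refl {κ₀}))))
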